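{- Let $p$ and $q$ be two odd prime numbers with $p < q$. Then the Sombor index of the total graph $T_\Gamma(\mathbb{Z}_{p^2q})$ is $$SO(T_\Gamma(\mathbb{Z}_{p^2q})) = \sqrt{2}\,\alpha\,(p^2q-\phi(p^2q)-1) + \beta\sqrt{(p^2q-\phi(p^2q)-1)^2+(p^2q-\phi(p^2q))^2} + \sqrt{2}\,(|E|-\alpha-\beta)(p^2q-\phi(p^2q)),$$ where $$\alpha = \frac{p(q-1)(p(q-1)-1)}{2}+ \frac{p(p-1)(p(p-1)-1)}{2}+\frac{p(p-1)}{2} +p^2(q-1)+p^2(p-1),$$ $$\beta = 2p^2(p-1)(q-1),\qquad |E| = \frac{p(p+q-1)(p^2q-1)}{2}.$$
   Context: For a finite simple graph $G$, the Sombor index is $SO(G)=\sum_{uv\in E(G)}\sqrt{d_u^2+d_v^2}$, the sum being over (unordered) edges, where $d_x$ is the degree of the vertex $x$. For a commutative ring $R$ with unity, $Z(R)$ denotes the set of zero-divisors of $R$, including $0$. The total graph $T_\Gamma(R)$ is the simple graph whose vertices are all elements of $R$, with distinct vertices $x,y$ adjacent if and only if $x+y\in Z(R)$. $\mathbb{Z}_n$ is the ring of integers modulo $n$ and $\phi$ is Euler's totient function. -}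

module Defs where

open import Algebra.Bundles using (CommutativeRing)
open import Algebra.Structures using (IsCommutativeRing)
open import Data.Fin.Base as Fin using (Fin; toℕ)
import Data.Fin.Properties as Fin
open import Data.Integer.Base as ℤ using (+_; -[1+_])
import Data.Integer.Properties as ℤ
open import Data.Integer.Tactic.RingSolver using () renaming (solve-∀ to ℤ-solve)
open import Data.List.Base using (List; length; filter; map; foldr; allFin; upTo; cartesianProduct)
open import Data.Nat.Base as ℕ using (ℕ; zero; suc)
open import Data.Nat.Coprimality using (coprime?)
import Data.Nat.DivMod as ℕ
open import Data.Nat.Primality using (Prime; prime⇒nonZero)
import Data.Nat.Properties as ℕ
open import Data.Product.Base using (∃-syntax; _×_; _,_)
open import Data.Rational.Base as ℚ using (ℚ; 0ℚ; 1ℚ; ½; mkℚ; ∣_∣; toℚᵘ)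
import Data.Rational.Properties as ℚ
open import Data.Rational.Solver using (module +-*-Solver)
import Data.Rational.Unnormalised.Base as ℚᵘ
import Data.Rational.Unnormalised.Properties as ℚᵘ
open import Data.Sum.Base as Sum using (_⊎_; inj₁; inj₂)
open import Function.Base using (case_of_)
open import Level using (0ℓ; _⊔_)
open import Relation.Binary.Core using (Rel)
open import Relation.Binary.Definitions using (Decidable; Symmetric; Irreflexive)
open import Relation.Binary.PropositionalEquality using (_≡_; refl; sym; trans; cong; cong₂; subst; subst₂; isEquivalence; module ≡-Reasoning)
open import Relation.Nullary using (¬_; yes; no)
open import Relation.Nullary.Decidable using (_×-dec_; _⊎-dec_; ¬?)
import Relation.Unary as Unary

IsCauchy : (ℕ → ℚ) → Set
IsCauchy s = ∀ ε → 0ℚ ℚ.< ε →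
  ∃[ N ] (∀ m n → N ℕ.≤ m → N ℕ.≤ n → ∣ s m ℚ.- s n ∣ ℚ.< ε)

record ℝ : Set where
  constructor mkℝ
  field
    seq      : ℕ → ℚ
    isCauchy : IsCauchy seq

open ℝ public

infix 4 _≃_

record _≃_ (x y : ℝ) : Set where
  constructor mk≃
  field
    converge : ∀ ε → 0ℚ ℚ.< ε →
      ∃[ N ] (∀ n → N ℕ.≤ n → ∣ seq x n ℚ.- seq y n ∣ ℚ.< ε)

module ℚ-arithmetic where
  open +-*-Solver

  half-pos : ∀ {ε} → 0ℚ ℚ.< ε → 0ℚ ℚ.< ½ ℚ.* ε
  half-pos {ε} 0<ε = subst (ℚ._< ½ ℚ.* ε) (ℚ.*-zeroʳ ½) (ℚ.*-monoʳ-<-pos ½ 0<ε)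

  half+half : ∀ ε → ½ ℚ.* ε ℚ.+ ½ ℚ.* ε ≡ ε
  half+half ε = trans (sym (ℚ.*-distribʳ-+ ε ½ ½)) (ℚ.*-identityˡ ε)

  pos*pos : ∀ {x y} → 0ℚ ℚ.< x → 0ℚ ℚ.< y → 0ℚ ℚ.< x ℚ.* y
  pos*pos {x} {y} 0<x 0<y = subst (ℚ._< x ℚ.* y) (ℚ.*-zeroʳ x)
    (ℚ.*-monoʳ-<-pos x {{ℚ.positive 0<x}} 0<y)

  scale : ∀ {B ε} → 0ℚ ℚ.< B → 0ℚ ℚ.< ε → ∃[ δ ] 0ℚ ℚ.< δ × B ℚ.* δ ≡ ε
  scale {B} {ε} 0<B 0<ε = (ℚ.1/ B) ℚ.* ε , pos*pos (ℚ.positive⁻¹ (ℚ.1/ B) {{ℚ.1/pos⇒pos B}}) 0<ε ,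
    trans (sym (ℚ.*-assoc B (ℚ.1/ B) ε)) (trans (cong (ℚ._* ε) (ℚ.*-inverseʳ B)) (ℚ.*-identityˡ ε))
    where instance
      B⁺ : ℚ.Positive B
      B⁺ = ℚ.positive 0<B
      B≢0 : ℚ.NonZero B
      B≢0 = ℚ.pos⇒nonZero B

  bound : ∀ {a b c} → ∣ a ℚ.- b ∣ ℚ.< c → ∣ a ∣ ℚ.< c ℚ.+ ∣ b ∣
  bound {a} {b} a-b<c = ℚ.≤-<-trans
    (subst (λ t → ∣ t ∣ ℚ.≤ ∣ a ℚ.- b ∣ ℚ.+ ∣ b ∣)
      (solve 2 (λ a b → a :- b :+ b := a) refl a b)
      (ℚ.∣p+q∣≤∣p∣+∣q∣ (a ℚ.- b) b))
    (ℚ.+-monoˡ-< ∣ b ∣ a-b<c)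

  self-close : ∀ a {ε} → 0ℚ ℚ.< ε → ∣ a ℚ.- a ∣ ℚ.< ε
  self-close a {ε} = subst (λ t → ∣ t ∣ ℚ.< ε) (sym (ℚ.+-inverseʳ a))

  +-close : ∀ a b c d {ε} → ∣ a ℚ.- b ∣ ℚ.< ½ ℚ.* ε → ∣ c ℚ.- d ∣ ℚ.< ½ ℚ.* ε →
    ∣ (a ℚ.+ c) ℚ.- (b ℚ.+ d) ∣ ℚ.< ε
  +-close a b c d {ε} p q = subst₂ (λ s t → ∣ s ∣ ℚ.< t)
    (solve 4 (λ a b c d → (a :- b) :+ (c :- d) := (a :+ c) :- (b :+ d)) refl a b c d)
    (half+half ε)
    (ℚ.≤-<-trans (ℚ.∣p+q∣≤∣p∣+∣q∣ (a ℚ.- b) (c ℚ.- d)) (ℚ.+-mono-< p q))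

  neg-close : ∀ a b {ε} → ∣ b ℚ.- a ∣ ℚ.< ε → ∣ (ℚ.- a) ℚ.- (ℚ.- b) ∣ ℚ.< ε
  neg-close a b {ε} = subst (λ t → ∣ t ∣ ℚ.< ε)
    (solve 2 (λ a b → b :- a := (:- a) :- (:- b)) refl a b)

  *-abs-< : ∀ {a b B δ} → ∣ a ∣ ℚ.< B → 0ℚ ℚ.< B → ∣ b ∣ ℚ.< δ → ∣ a ℚ.* b ∣ ℚ.< B ℚ.* δ
  *-abs-< {a} {b} {B} {δ} a<B 0<B b<δ = subst (ℚ._< B ℚ.* δ) (sym (ℚ.∣p*q∣≡∣p∣*∣q∣ a b))
    (ℚ.≤-<-trans (ℚ.*-monoʳ-≤-nonNeg ∣ b ∣ {{ℚ.∣-∣-nonNeg b}} (ℚ.<⇒≤ a<B))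
                 (ℚ.*-monoʳ-<-pos B {{ℚ.positive 0<B}} b<δ))

  *-close : ∀ a b c d {B C δ η ε} →
    ∣ a ∣ ℚ.< B → 0ℚ ℚ.< B → ∣ d ∣ ℚ.< C → 0ℚ ℚ.< C →
    ∣ c ℚ.- d ∣ ℚ.< δ → ∣ a ℚ.- b ∣ ℚ.< η →
    B ℚ.* δ ≡ ½ ℚ.* ε → C ℚ.* η ≡ ½ ℚ.* ε →
    ∣ a ℚ.* c ℚ.- b ℚ.* d ∣ ℚ.< ε
  *-close a b c d {ε = ε} a<B 0<B d<C 0<C p q e₁ e₂ = subst₂ (λ s t → ∣ s ∣ ℚ.< t)
    (solve 4 (λ a b c d → a :* (c :- d) :+ d :* (a :- b) := a :* c :- b :* d) refl a b c d)
    (trans (cong₂ ℚ._+_ e₁ e₂) (half+half ε))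
    (ℚ.≤-<-trans (ℚ.∣p+q∣≤∣p∣+∣q∣ (a ℚ.* (c ℚ.- d)) (d ℚ.* (a ℚ.- b)))
      (ℚ.+-mono-< (*-abs-< a<B 0<B p) (*-abs-< d<C 0<C q)))

open ℚ-arithmetic

bounded : ∀ {s} → IsCauchy s →
  ∃[ N ] ∃[ B ] 0ℚ ℚ.< B × (∀ n → N ℕ.≤ n → ∣ s n ∣ ℚ.< B)
bounded {s} c with c 1ℚ (ℚ.positive⁻¹ 1ℚ)
... | N , close = N , 1ℚ ℚ.+ ∣ s N ∣ ,
  ℚ.+-mono-<-≤ (ℚ.positive⁻¹ 1ℚ) (ℚ.0≤∣p∣ (s N)) ,
  λ n N≤n → bound (close n N N≤n ℕ.≤-refl)

infixl 6 _+_ _-_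
infixl 7 _*_
infix  8 -_

fromℚ : ℚ → ℝ
fromℚ a = mkℝ (λ _ → a) λ ε 0<ε → 0 , λ _ _ _ _ → self-close a 0<ε

fromℕ : ℕ → ℝ
fromℕ n = fromℚ (+ n ℚ./ 1)

_+_ : ℝ → ℝ → ℝ
x + y = mkℝ (λ n → seq x n ℚ.+ seq y n) cauchy
  where
  cauchy : IsCauchy (λ n → seq x n ℚ.+ seq y n)
  cauchy ε 0<ε with isCauchy x (½ ℚ.* ε) (half-pos 0<ε) | isCauchy y (½ ℚ.* ε) (half-pos 0<ε)
  ... | N₁ , c₁ | N₂ , c₂ = N₁ ℕ.⊔ N₂ , λ m n N≤m N≤n →
    +-close (seq x m) (seq x n) (seq y m) (seq y n)
      (c₁ m n (ℕ.m⊔n≤o⇒m≤o N₁ N₂ N≤m) (ℕ.m⊔n≤o⇒m≤o N₁ N₂ N≤n))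
      (c₂ m n (ℕ.m⊔n≤o⇒n≤o N₁ N₂ N≤m) (ℕ.m⊔n≤o⇒n≤o N₁ N₂ N≤n))

-_ : ℝ → ℝ
- x = mkℝ (λ n → ℚ.- seq x n) cauchy
  where
  cauchy : IsCauchy (λ n → ℚ.- seq x n)
  cauchy ε 0<ε with isCauchy x ε 0<ε
  ... | N , c = N , λ m n N≤m N≤n → neg-close (seq x m) (seq x n) (c n m N≤n N≤m)

_-_ : ℝ → ℝ → ℝ
x - y = x + (- y)

*-isCauchy : ∀ {s t} → IsCauchy s → IsCauchy t → IsCauchy (λ n → s n ℚ.* t n)
*-isCauchy {s} {t} cs ct ε 0<ε =
  let (K₁ , B₁ , 0<B₁ , b₁) = bounded cs
      (K₂ , B₂ , 0<B₂ , b₂) = bounded ct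
      (δ₁ , 0<δ₁ , eq₁)     = scale 0<B₁ (half-pos 0<ε)
      (δ₂ , 0<δ₂ , eq₂)     = scale 0<B₂ (half-pos 0<ε)
      (N₁ , c₁)             = ct δ₁ 0<δ₁
      (N₂ , c₂)             = cs δ₂ 0<δ₂
  in (K₁ ℕ.⊔ N₁) ℕ.⊔ (K₂ ℕ.⊔ N₂) , λ m n N≤m N≤n →
  let l  = ℕ.m⊔n≤o⇒m≤o (K₁ ℕ.⊔ N₁) (K₂ ℕ.⊔ N₂) N≤m
      l′ = ℕ.m⊔n≤o⇒m≤o (K₁ ℕ.⊔ N₁) (K₂ ℕ.⊔ N₂) N≤n
      r  = ℕ.m⊔n≤o⇒n≤o (K₁ ℕ.⊔ N₁) (K₂ ℕ.⊔ N₂) N≤m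
      r′ = ℕ.m⊔n≤o⇒n≤o (K₁ ℕ.⊔ N₁) (K₂ ℕ.⊔ N₂) N≤n
  in *-close (s m) (s n) (t m) (t n)
    (b₁ m (ℕ.m⊔n≤o⇒m≤o K₁ N₁ l)) 0<B₁ (b₂ n (ℕ.m⊔n≤o⇒m≤o K₂ N₂ r′)) 0<B₂
    (c₁ m n (ℕ.m⊔n≤o⇒n≤o K₁ N₁ l) (ℕ.m⊔n≤o⇒n≤o K₁ N₁ l′))
    (c₂ m n (ℕ.m⊔n≤o⇒n≤o K₂ N₂ r) (ℕ.m⊔n≤o⇒n≤o K₂ N₂ r′))
    eq₁ eq₂

_*_ : ℝ → ℝ → ℝ
x * y = mkℝ (λ n → seq x n ℚ.* seq y n) (*-isCauchy {seq x} {seq y} (isCauchy x) (isCauchy y))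

-- The largest r ≤ b satisfying P, or 0 if there is none.
greatest : {P : ℕ → Set} → Unary.Decidable P → ℕ → ℕ
greatest P? zero = zero
greatest P? (suc b) with P? (suc b)
... | yes _ = suc b
... | no  _ = greatest P? b

greatest-sound : ∀ {P : ℕ → Set} (P? : Unary.Decidable P) b →
  greatest P? b ≡ 0 ⊎ P (greatest P? b)
greatest-sound P? zero = inj₁ refl
greatest-sound P? (suc b) with P? (suc b)
... | yes p = inj₂ p
... | no  _ = greatest-sound P? b

greatest-maximal : ∀ {P : ℕ → Set} (P? : Unary.Decidable P) b {s} →
  greatest P? b ℕ.< s → s ℕ.≤ b → ¬ P s
greatest-maximal P? zero r<s s≤b _ = ℕ.<-irrefl refl (ℕ.<-≤-trans r<s s≤b)
greatest-maximal P? (suc b) r<s s≤b with P? (suc b)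
... | yes _ = λ _ → ℕ.<-irrefl refl (ℕ.<-≤-trans r<s s≤b)
... | no ¬p with ℕ.m≤n⇒m<n∨m≡n s≤b
...   | inj₁ s<1+b = greatest-maximal P? b r<s (ℕ.≤-pred s<1+b)
...   | inj₂ refl  = ¬p

sq : ℚ → ℚ
sq a = a ℚ.* a

frac : ℕ → ℕ → ℚ
frac r m = + r ℚ./ suc m

rootBound : ℚ → ℕ → ℕ
rootBound y m = suc m ℕ.* ℤ.∣ ℚ.↥ y ∣

squareBelow? : ∀ y m → Unary.Decidable (λ r → sq (frac r m) ℚ.≤ y)
squareBelow? y m r = sq (frac r m) ℚ.≤? y

rootNumerator : ℚ → ℕ → ℕ
rootNumerator y m = greatest (squareBelow? y m) (rootBound y m)

-- root y m = r / (m + 1) with r the largest natural number such that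
-- (r / (m + 1))² ≤ y, or r = 0 if y is negative.  No such r exceeds
-- rootBound y m, so restricting the search to r ≤ rootBound y m is harmless.
root : ℚ → ℕ → ℚ
root y m = frac (rootNumerator y m) m

module root-properties where

  frac-toℚᵘ : ∀ r m → toℚᵘ (frac r m) ℚᵘ.≃ ℚᵘ.mkℚᵘ (+ r) m
  frac-toℚᵘ r m = ℚ.toℚᵘ-fromℚᵘ (ℚᵘ.mkℚᵘ (+ r) m)

  frac-nonNeg : ∀ r m → 0ℚ ℚ.≤ frac r m
  frac-nonNeg r m = ℚ.nonNegative⁻¹ (frac r m) {{ℚ.normalize-nonNeg r (suc m)}}

  frac-suc : ∀ r m → frac (suc r) m ≡ frac r m ℚ.+ frac 1 m
  frac-suc r m = ℚ.toℚᵘ-injective (ℚᵘ.≃-trans (frac-toℚᵘ (suc r) m) (ℚᵘ.≃-sym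
    (ℚᵘ.≃-trans (ℚ.toℚᵘ-homo-+ (frac r m) (frac 1 m))
      (ℚᵘ.≃-trans (ℚᵘ.+-cong (frac-toℚᵘ r m) (frac-toℚᵘ 1 m))
        (ℚᵘ.*≡* (trans (identity (+ r) (+ suc m)) (cong ((+ suc r) ℤ.*_) (sym (ℤ.pos-* (suc m) (suc m))))))))))
    where
    identity : ∀ a c → (a ℤ.* c ℤ.+ + 1 ℤ.* c) ℤ.* c ≡ (+ 1 ℤ.+ a) ℤ.* (c ℤ.* c)
    identity = ℤ-solve

  frac-small : ∀ {ε} → 0ℚ ℚ.< ε → ∃[ N ] (∀ n → N ℕ.≤ n → frac 1 n ℚ.≤ ε)
  frac-small {mkℚ (+ zero) d _} (ℚ.*<* (ℤ.+<+ ()))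
  frac-small {mkℚ -[1+ _ ] d _} (ℚ.*<* ())
  frac-small {mkℚ (+ suc k) d c} _ = d , λ n d≤n → ℚ.toℚᵘ-cancel-≤
    (ℚᵘ.≤-respˡ-≃ (ℚᵘ.≃-sym (frac-toℚᵘ 1 n)) (ℚᵘ.*≤* (subst₂ ℤ._≤_
      (ℤ.pos-* 1 (suc d)) (ℤ.pos-* (suc k) (suc n))
      (ℤ.+≤+ (ℕ.*-mono-≤ {1} {suc k} (ℕ.s≤s ℕ.z≤n) (ℕ.s≤s d≤n))))))

  root-nonNeg : ∀ y m → 0ℚ ℚ.≤ root y m
  root-nonNeg y m = frac-nonNeg (rootNumerator y m) m

  root-sound : ∀ y m → root y m ≡ 0ℚ ⊎ sq (root y m) ℚ.≤ y
  root-sound y m = Sum.map₁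
    (λ r≡0 → trans (cong (λ r → frac r m) r≡0) (ℚ.0/n≡0 (suc m)))
    (greatest-sound (squareBelow? y m) (rootBound y m))

  bound-large : ∀ y m {s} → rootBound y m ℕ.< s → y ℚ.< sq (frac s m)
  bound-large y@(mkℚ a d _) m {s} b<s = ℚ.toℚᵘ-cancel-< (ℚᵘ.<-respʳ-≃
    (ℚᵘ.≃-sym (ℚᵘ.≃-trans (ℚ.toℚᵘ-homo-* (frac s m) (frac s m)) (ℚᵘ.*-cong (frac-toℚᵘ s m) (frac-toℚᵘ s m))))
    (ℚᵘ.*<* (below a b<s)))
    where
    below : ∀ a → suc m ℕ.* ℤ.∣ a ∣ ℕ.< s →
      a ℤ.* + (suc m ℕ.* suc m) ℤ.< ((+ s) ℤ.* (+ s)) ℤ.* + suc d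
    below (+ zero) b<s = subst (+ 0 ℤ.<_)
      (trans (ℤ.pos-* (s ℕ.* s) (suc d)) (cong (ℤ._* + suc d) (ℤ.pos-* s s)))
      (ℤ.+<+ (ℕ.*-mono-< (ℕ.*-mono-< 0<s 0<s) (ℕ.s≤s ℕ.z≤n)))
      where
      0<s : 0 ℕ.< s
      0<s = ℕ.≤-<-trans ℕ.z≤n b<s
    below (+ suc t) b<s = subst₂ ℤ._<_
      (ℤ.pos-* (suc t) (suc m ℕ.* suc m))
      (trans (ℤ.pos-* (s ℕ.* s) (suc d)) (cong (ℤ._* + suc d) (ℤ.pos-* s s)))
      (ℤ.+<+ (ℕ.≤-<-trans step (ℕ.<-≤-trans (ℕ.*-mono-< b<s b<s) (ℕ.m≤m*n (s ℕ.* s) (suc d)))))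
      where
      step : suc t ℕ.* (suc m ℕ.* suc m) ℕ.≤ (suc m ℕ.* suc t) ℕ.* (suc m ℕ.* suc t)
      step = subst₂ ℕ._≤_ (ℕ.*-comm (suc m ℕ.* suc m) (suc t))
        (ℕ.[m*n]*[o*p]≡[m*o]*[n*p] (suc m) (suc m) (suc t) (suc t))
        (ℕ.*-monoʳ-≤ (suc m ℕ.* suc m) (ℕ.m≤m*n (suc t) (suc t)))
    below -[1+ t ] b<s = subst (-[1+ t ] ℤ.* + (suc m ℕ.* suc m) ℤ.<_)
      (trans (ℤ.pos-* (s ℕ.* s) (suc d)) (cong (ℤ._* + suc d) (ℤ.pos-* s s)))
      ℤ.-<+

  root-maximal : ∀ y m → y ℚ.< sq (root y m ℚ.+ frac 1 m)
  root-maximal y m = subst (λ t → y ℚ.< sq t) (frac-suc (rootNumerator y m) m) below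
    where
    below : y ℚ.< sq (frac (suc (rootNumerator y m)) m)
    below = case (suc (rootNumerator y m) ℕ.≤? rootBound y m) of λ where
      (yes r<b) → ℚ.≰⇒> (greatest-maximal (squareBelow? y m) (rootBound y m) ℕ.≤-refl r<b)
      (no  r≮b) → bound-large y m (ℕ.≰⇒> r≮b)

  sq-mono-≤ : ∀ {a b} → 0ℚ ℚ.≤ a → a ℚ.≤ b → sq a ℚ.≤ sq b
  sq-mono-≤ {a} {b} 0≤a a≤b = ℚ.≤-trans
    (ℚ.*-monoʳ-≤-nonNeg a {{ℚ.nonNegative 0≤a}} a≤b)
    (ℚ.*-monoˡ-≤-nonNeg b {{ℚ.nonNegative (ℚ.≤-trans 0≤a a≤b)}} a≤b)

  root-close : ∀ {a b u v w e} → 0ℚ ℚ.< e → 0ℚ ℚ.≤ b → 0ℚ ℚ.≤ w → w ℚ.≤ e →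
    a ≡ 0ℚ ⊎ sq a ℚ.≤ u → v ℚ.< sq (b ℚ.+ w) → u ℚ.- v ℚ.< sq e →
    a ℚ.< b ℚ.+ (e ℚ.+ e)
  root-close {a} {b} {u} {v} {w} {e} 0<e 0≤b 0≤w w≤e (inj₁ refl) _ _ =
    ℚ.+-mono-≤-< 0≤b (ℚ.+-mono-< 0<e 0<e)
  root-close {a} {b} {u} {v} {w} {e} 0<e 0≤b 0≤w w≤e (inj₂ a²≤u) v<[b+w]² u-v<e² =
    ℚ.≰⇒> λ b+2e≤a → ℚ.<-irrefl refl (begin-strict
      u                                           ≡⟨ split u v ⟩
      v ℚ.+ (u ℚ.- v)                             <⟨ ℚ.+-mono-< v<[b+w]² u-v<e² ⟩
      sq (b ℚ.+ w) ℚ.+ sq e                       ≤⟨ ℚ.+-monoˡ-≤ (sq e) (sq-mono-≤ (ℚ.+-mono-≤ 0≤b 0≤w) (ℚ.+-monoʳ-≤ b w≤e)) ⟩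
      sq (b ℚ.+ e) ℚ.+ sq e                       ≡⟨ sym (ℚ.+-identityʳ _) ⟩
      (sq (b ℚ.+ e) ℚ.+ sq e) ℚ.+ 0ℚ              ≤⟨ ℚ.+-monoʳ-≤ (sq (b ℚ.+ e) ℚ.+ sq e) cross≥0 ⟩
      (sq (b ℚ.+ e) ℚ.+ sq e) ℚ.+ (cross ℚ.+ cross) ≡⟨ expand b e ⟩
      sq (b ℚ.+ (e ℚ.+ e))                        ≤⟨ sq-mono-≤ (ℚ.+-mono-≤ 0≤b (ℚ.+-mono-≤ 0≤e 0≤e)) b+2e≤a ⟩
      sq a                                        ≤⟨ a²≤u ⟩
      u                                           ∎)
    where
    open ℚ.≤-Reasoning
    open +-*-Solver
    0≤e : 0ℚ ℚ.≤ e
    0≤e = ℚ.<⇒≤ 0<e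
    cross : ℚ
    cross = e ℚ.* (b ℚ.+ e)
    cross≥0₁ : 0ℚ ℚ.≤ cross
    cross≥0₁ = ℚ.nonNegative⁻¹ cross {{ℚ.nonNeg*nonNeg⇒nonNeg e {{ℚ.nonNegative 0≤e}} (b ℚ.+ e) {{ℚ.nonNegative (ℚ.+-mono-≤ 0≤b 0≤e)}}}}
    cross≥0 : 0ℚ ℚ.≤ cross ℚ.+ cross
    cross≥0 = ℚ.+-mono-≤ cross≥0₁ cross≥0₁
    split : ∀ u v → u ≡ v ℚ.+ (u ℚ.- v)
    split = solve 2 (λ u v → u := v :+ (u :- v)) refl
    expand : ∀ b e → (sq (b ℚ.+ e) ℚ.+ sq e) ℚ.+ (e ℚ.* (b ℚ.+ e) ℚ.+ e ℚ.* (b ℚ.+ e)) ≡ sq (b ℚ.+ (e ℚ.+ e))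
    expand = solve 2 (λ b e → ((b :+ e) :* (b :+ e) :+ e :* e) :+ (e :* (b :+ e) :+ e :* (b :+ e))
                          := (b :+ (e :+ e)) :* (b :+ (e :+ e))) refl

  p≤∣p∣ : ∀ p → p ℚ.≤ ∣ p ∣
  p≤∣p∣ p with ℚ.≤-total 0ℚ p
  ... | inj₁ 0≤p = ℚ.≤-reflexive (sym (ℚ.0≤p⇒∣p∣≡p 0≤p))
  ... | inj₂ p≤0 = ℚ.≤-trans p≤0 (ℚ.0≤∣p∣ p)

  ∣a-b∣≡∣b-a∣ : ∀ a b → ∣ a ℚ.- b ∣ ≡ ∣ b ℚ.- a ∣
  ∣a-b∣≡∣b-a∣ a b = trans (cong ∣_∣ (solve 2 (λ a b → a :- b := :- (b :- a)) refl a b)) (ℚ.∣-p∣≡∣p∣ (b ℚ.- a))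
    where open +-*-Solver

  ∣-∣-< : ∀ {a b ε} → a ℚ.< b ℚ.+ ε → b ℚ.< a ℚ.+ ε → ∣ a ℚ.- b ∣ ℚ.< ε
  ∣-∣-< {a} {b} {ε} a<b+ε b<a+ε with ℚ.∣p∣≡p∨∣p∣≡-p (a ℚ.- b)
  ... | inj₁ eq = subst₂ ℚ._<_ (sym eq)
    (solve 2 (λ b ε → (b :+ ε) :- b := ε) refl b ε) (ℚ.+-monoˡ-< (ℚ.- b) a<b+ε)
    where open +-*-Solver
  ... | inj₂ eq = subst₂ ℚ._<_ (trans (solve 2 (λ a b → b :- a := :- (a :- b)) refl a b) (sym eq))
    (solve 2 (λ a ε → (a :+ ε) :- a := ε) refl a ε) (ℚ.+-monoˡ-< (ℚ.- a) b<a+ε)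
    where open +-*-Solver

  root-isCauchy : ∀ {s} → IsCauchy s → IsCauchy (λ n → root (s n) n)
  root-isCauchy {s} cs ε 0<ε =
    let e       = ½ ℚ.* ε
        0<e     = half-pos 0<ε
        N₁ , c₁ = cs (sq e) (pos*pos 0<e 0<e)
        N₂ , c₂ = frac-small 0<e
        close : ∀ m n → N₁ ℕ.⊔ N₂ ℕ.≤ m → N₁ ℕ.⊔ N₂ ℕ.≤ n → root (s m) m ℚ.< root (s n) n ℚ.+ ε
        close m n N≤m N≤n = subst (λ t → root (s m) m ℚ.< root (s n) n ℚ.+ t) (half+half ε)
          (root-close 0<e (root-nonNeg (s n) n) (frac-nonNeg 1 n) (c₂ n (ℕ.m⊔n≤o⇒n≤o N₁ N₂ N≤n))
            (root-sound (s m) m) (root-maximal (s n) n)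
            (ℚ.≤-<-trans (p≤∣p∣ (s m ℚ.- s n)) (c₁ m n (ℕ.m⊔n≤o⇒m≤o N₁ N₂ N≤m) (ℕ.m⊔n≤o⇒m≤o N₁ N₂ N≤n))))
    in N₁ ℕ.⊔ N₂ , λ m n N≤m N≤n → ∣-∣-< (close m n N≤m N≤n) (close n m N≤n N≤m)

-- The n-th term approximates √ (seq x n) from below within 1 / (n + 1).
-- On negative reals the value is 0.
√ : ℝ → ℝ
√ x = mkℝ (λ n → root (seq x n) n) (root-properties.root-isCauchy {seq x} (isCauchy x))

record SimpleGraph (n : ℕ) : Set₁ where
  field
    Adj        : Rel (Fin n) 0ℓ
    adj?       : Decidable Adj
    adj-sym    : Symmetric Adj
    adj-irrefl : Irreflexive _≡_ Adj

  degree : Fin n → ℕ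
  degree u = length (filter (adj? u) (allFin n))

  -- Each unordered edge is listed once, with its smaller endpoint first.
  edges : List (Fin n × Fin n)
  edges = filter (λ (u , v) → (u Fin.<? v) ×-dec adj? u v) (cartesianProduct (allFin n) (allFin n))

sumℝ : List ℝ → ℝ
sumℝ = foldr _+_ (fromℕ 0)

SO : ∀ {n} → SimpleGraph n → ℝ
SO G = sumℝ (map (λ (u , v) → √ (fromℕ (degree u ℕ.^ 2 ℕ.+ degree v ℕ.^ 2))) edges)
  where open SimpleGraph G

module _ {c ℓ} (R : CommutativeRing c ℓ) where
  open CommutativeRing R using (Carrier; _≈_; _≉_; 0#) renaming (_+_ to _⊕_; _*_ to _⊗_)

  IsZeroDivisor : Carrier → Set (c ⊔ ℓ)
  IsZeroDivisor x = x ≈ 0# ⊎ (∃[ y ] y ≉ 0# × x ⊗ y ≈ 0#)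

  TotalAdjacent : Carrier → Carrier → Set (c ⊔ ℓ)
  TotalAdjacent x y = x ≉ y × IsZeroDivisor (x ⊕ y)

TΓ : ∀ {n} {_⊕_ _⊗_ : Fin n → Fin n → Fin n} {⊖_ : Fin n → Fin n} {0# 1# : Fin n} →
  IsCommutativeRing _≡_ _⊕_ _⊗_ ⊖_ 0# 1# → SimpleGraph n
TΓ {n} {_⊕_} {_⊗_} {⊖_} {0#} {1#} isCommutativeRing = record
  { Adj        = TotalAdjacent R
  ; adj?       = λ x y → ¬? (x Fin.≟ y) ×-dec zeroDivisor? (x ⊕ y)
  ; adj-sym    = λ {x} {y} (x≢y , z) → (λ y≡x → x≢y (sym y≡x)) , subst (IsZeroDivisor R) (+-comm x y) z
  ; adj-irrefl = λ x≡y (x≢y , _) → x≢y x≡y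
  }
  where
  R : CommutativeRing 0ℓ 0ℓ
  R = record { isCommutativeRing = isCommutativeRing }
  open IsCommutativeRing isCommutativeRing using (+-comm)
  zeroDivisor? : Unary.Decidable (IsZeroDivisor R)
  zeroDivisor? x = (x Fin.≟ 0#) ⊎-dec Fin.any? (λ y → ¬? (y Fin.≟ 0#) ×-dec ((x ⊗ y) Fin.≟ 0#))

module ℤmod (n : ℕ) .{{_ : ℕ.NonZero n}} where

  [_] : ℕ → Fin n
  [ k ] = k ℕ.mod n

  _⊕_ _⊗_ : Fin n → Fin n → Fin n
  x ⊕ y = [ toℕ x ℕ.+ toℕ y ]
  x ⊗ y = [ toℕ x ℕ.* toℕ y ]

  ⊖_ : Fin n → Fin n
  ⊖ x = [ n ℕ.∸ toℕ x ]

  toℕ-[] : ∀ k → toℕ [ k ] ≡ k ℕ.% n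
  toℕ-[] k = Fin.toℕ-fromℕ< (ℕ.m%n<n k n)

  []-cong : ∀ {j k} → j ℕ.% n ≡ k ℕ.% n → [ j ] ≡ [ k ]
  []-cong {j} {k} eq = Fin.toℕ-injective (trans (toℕ-[] j) (trans eq (sym (toℕ-[] k))))

  []-toℕ : ∀ x → [ toℕ x ] ≡ x
  []-toℕ x = Fin.toℕ-injective (trans (toℕ-[] (toℕ x)) (ℕ.m<n⇒m%n≡m (Fin.toℕ<n x)))

  ⊕-homo : ∀ j k → [ j ] ⊕ [ k ] ≡ [ j ℕ.+ k ]
  ⊕-homo j k = []-cong (trans (cong₂ (λ a b → (a ℕ.+ b) ℕ.% n) (toℕ-[] j) (toℕ-[] k)) (sym (ℕ.%-distribˡ-+ j k n)))

  ⊗-homo : ∀ j k → [ j ] ⊗ [ k ] ≡ [ j ℕ.* k ]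
  ⊗-homo j k = []-cong (trans (cong₂ (λ a b → (a ℕ.* b) ℕ.% n) (toℕ-[] j) (toℕ-[] k)) (sym (ℕ.%-distribˡ-* j k n)))

  ⊕-homoˡ : ∀ j y → [ j ] ⊕ y ≡ [ j ℕ.+ toℕ y ]
  ⊕-homoˡ j y = trans (cong ([ j ] ⊕_) (sym ([]-toℕ y))) (⊕-homo j (toℕ y))

  ⊗-homoˡ : ∀ j y → [ j ] ⊗ y ≡ [ j ℕ.* toℕ y ]
  ⊗-homoˡ j y = trans (cong ([ j ] ⊗_) (sym ([]-toℕ y))) (⊗-homo j (toℕ y))

  ⊕-comm : ∀ x y → x ⊕ y ≡ y ⊕ x
  ⊕-comm x y = cong [_] (ℕ.+-comm (toℕ x) (toℕ y))

  ⊗-comm : ∀ x y → x ⊗ y ≡ y ⊗ x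
  ⊗-comm x y = cong [_] (ℕ.*-comm (toℕ x) (toℕ y))

  ⊕-assoc : ∀ x y z → (x ⊕ y) ⊕ z ≡ x ⊕ (y ⊕ z)
  ⊕-assoc x y z = begin
    (x ⊕ y) ⊕ z                     ≡⟨ ⊕-homoˡ (toℕ x ℕ.+ toℕ y) z ⟩
    [ toℕ x ℕ.+ toℕ y ℕ.+ toℕ z ]   ≡⟨ cong [_] (ℕ.+-assoc (toℕ x) (toℕ y) (toℕ z)) ⟩
    [ toℕ x ℕ.+ (toℕ y ℕ.+ toℕ z) ] ≡⟨ cong [_] (ℕ.+-comm (toℕ x) (toℕ y ℕ.+ toℕ z)) ⟩
    [ toℕ y ℕ.+ toℕ z ℕ.+ toℕ x ]   ≡⟨ ⊕-homoˡ (toℕ y ℕ.+ toℕ z) x ⟨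
    (y ⊕ z) ⊕ x                     ≡⟨ ⊕-comm (y ⊕ z) x ⟩
    x ⊕ (y ⊕ z)                     ∎
    where open ≡-Reasoning

  ⊗-assoc : ∀ x y z → (x ⊗ y) ⊗ z ≡ x ⊗ (y ⊗ z)
  ⊗-assoc x y z = begin
    (x ⊗ y) ⊗ z                     ≡⟨ ⊗-homoˡ (toℕ x ℕ.* toℕ y) z ⟩
    [ toℕ x ℕ.* toℕ y ℕ.* toℕ z ]   ≡⟨ cong [_] (ℕ.*-assoc (toℕ x) (toℕ y) (toℕ z)) ⟩
    [ toℕ x ℕ.* (toℕ y ℕ.* toℕ z) ] ≡⟨ cong [_] (ℕ.*-comm (toℕ x) (toℕ y ℕ.* toℕ z)) ⟩
    [ toℕ y ℕ.* toℕ z ℕ.* toℕ x ]   ≡⟨ ⊗-homoˡ (toℕ y ℕ.* toℕ z) x ⟨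
    (y ⊗ z) ⊗ x                     ≡⟨ ⊗-comm (y ⊗ z) x ⟩
    x ⊗ (y ⊗ z)                     ∎
    where open ≡-Reasoning

  ⊕-identityˡ : ∀ x → [ 0 ] ⊕ x ≡ x
  ⊕-identityˡ x = trans (⊕-homoˡ 0 x) ([]-toℕ x)

  ⊗-identityˡ : ∀ x → [ 1 ] ⊗ x ≡ x
  ⊗-identityˡ x = trans (⊗-homoˡ 1 x) (trans (cong [_] (ℕ.*-identityˡ (toℕ x))) ([]-toℕ x))

  ⊖-inverseˡ : ∀ x → (⊖ x) ⊕ x ≡ [ 0 ]
  ⊖-inverseˡ x = trans (⊕-homoˡ (n ℕ.∸ toℕ x) x)
    (trans (cong [_] (ℕ.m∸n+n≡m (ℕ.<⇒≤ (Fin.toℕ<n x)))) ([]-cong (trans (ℕ.n%n≡0 n) (sym (ℕ.m*n%n≡0 0 n)))))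

  ⊗-distribˡ-⊕ : ∀ x y z → x ⊗ (y ⊕ z) ≡ (x ⊗ y) ⊕ (x ⊗ z)
  ⊗-distribˡ-⊕ x y z = begin
    x ⊗ (y ⊕ z)                               ≡⟨ ⊗-comm x (y ⊕ z) ⟩
    (y ⊕ z) ⊗ x                               ≡⟨ ⊗-homoˡ (toℕ y ℕ.+ toℕ z) x ⟩
    [ (toℕ y ℕ.+ toℕ z) ℕ.* toℕ x ]           ≡⟨ cong [_] (ℕ.*-comm (toℕ y ℕ.+ toℕ z) (toℕ x)) ⟩
    [ toℕ x ℕ.* (toℕ y ℕ.+ toℕ z) ]           ≡⟨ cong [_] (ℕ.*-distribˡ-+ (toℕ x) (toℕ y) (toℕ z)) ⟩
    [ toℕ x ℕ.* toℕ y ℕ.+ toℕ x ℕ.* toℕ z ]   ≡⟨ ⊕-homo (toℕ x ℕ.* toℕ y) (toℕ x ℕ.* toℕ z) ⟨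
    (x ⊗ y) ⊕ (x ⊗ z)                         ∎
    where open ≡-Reasoning

  isCommutativeRing : IsCommutativeRing _≡_ _⊕_ _⊗_ ⊖_ [ 0 ] [ 1 ]
  isCommutativeRing = record
    { isRing = record
      { +-isAbelianGroup = record
        { isGroup = record
          { isMonoid = record
            { isSemigroup = record
              { isMagma = record { isEquivalence = isEquivalence ; ∙-cong = cong₂ _⊕_ }
              ; assoc   = ⊕-assoc
              }
            ; identity = ⊕-identityˡ , λ x → trans (⊕-comm x [ 0 ]) (⊕-identityˡ x)
            }
          ; inverse = ⊖-inverseˡ , λ x → trans (⊕-comm x (⊖ x)) (⊖-inverseˡ x)
          ; ⁻¹-cong = cong ⊖_
          }
        ; comm = ⊕-comm
        }
      ; *-cong     = cong₂ _⊗_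
      ; *-assoc    = ⊗-assoc
      ; *-identity = ⊗-identityˡ , λ x → trans (⊗-comm x [ 1 ]) (⊗-identityˡ x)
      ; distrib    = ⊗-distribˡ-⊕ , λ x y z →
          trans (⊗-comm (y ⊕ z) x) (trans (⊗-distribˡ-⊕ x y z) (cong₂ _⊕_ (⊗-comm x y) (⊗-comm x z)))
      }
    ; *-comm = ⊗-comm
    }

ℤ/_ : ∀ n .{{_ : ℕ.NonZero n}} → (let open ℤmod n) →
  IsCommutativeRing _≡_ _⊕_ _⊗_ ⊖_ [ 0 ] [ 1 ]
ℤ/ n = ℤmod.isCommutativeRing n

-- The number of k with 1 ≤ k ≤ n and gcd(k, n) = 1.
φ : ℕ → ℕ
φ n = length (filter (λ k → coprime? k n) (map suc (upTo n)))

p²q-nonZero : ∀ {p q} → Prime p → Prime q → ℕ.NonZero (p ℕ.^ 2 ℕ.* q)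
p²q-nonZero {p} {q} p-prime q-prime = ℕ.m*n≢0 (p ℕ.^ 2) q {{ℕ.m^n≢0 p 2}}
  where instance
    p≢0 : ℕ.NonZero p
    p≢0 = prime⇒nonZero p-prime
    q≢0 : ℕ.NonZero q
    q≢0 = prime⇒nonZero q-prime

-- Let S be the set of zero divisors of ℤ/p²q, the residues divisible by p or by
-- q, and z = |S| = p²q - φ(p²q).  Translation by u permutes ℤ/p²q, and 2u ∈ S iff
-- u ∈ S because p and q are odd; so u has degree z - 1 if u ∈ S and z otherwise.
-- Summing degrees over S and over its complement gives two linear equations for
-- the numbers of edges with two, one or no end in S.  The third comes from
-- translation again: for u ∈ S there are as many v ∉ S with u + v ∈ S as there are
-- v ∈ S with u + v ∉ S, and the latter are the pairs in which one residue is
-- divisible by p only and the other by q only.  What remains is √(2k²) = k√2.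
module Submission where

open import Defs
open import Algebra.Bundles using (CommutativeRing)
open import Data.Bool.Base using (true; false; if_then_else_)
open import Data.Fin.Base using (Fin; zero; suc; toℕ)
open import Data.Fin.Permutation using (Permutation; permutation)
import Data.Fin.Properties as Fin
open import Data.Integer.Base as ℤ using (+_)
import Data.Integer.Properties as ℤ
open import Data.Integer.Tactic.RingSolver using () renaming (solve-∀ to ℤ-solve)
open import Data.List.Base using (List; []; _∷_; _++_; length; filter; map; allFin; tabulate; upTo; applyUpTo; cartesianProduct)
import Data.Nat.Base as ℕ
open import Data.Nat.Base using (ℕ; zero; suc; _^_; _<_) renaming (_*_ to _·_)
open import Data.Nat.Coprimality using (Coprime; coprime?; coprime-divisor) renaming (sym to coprime-sym)
open import Data.Nat.Divisibility
import Data.Nat.DivMod as ℕ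
open import Data.Nat.Primality using (Prime; prime⇒nonZero; prime⇒nonTrivial; prime⇒irreducible; prime[2]; euclidsLemma)
import Data.Nat.Properties as ℕ
open import Data.Nat.Tactic.RingSolver using (solve-∀)
open import Data.Product.Base using (∃-syntax; _×_; _,_; proj₁; proj₂)
import Data.Rational.Base as ℚ
open import Data.Rational.Base using (ℚ; 0ℚ; 1ℚ; ½)
import Data.Rational.Properties as ℚ
open import Data.Rational.Solver using (module +-*-Solver)
import Data.Rational.Unnormalised.Base as ℚᵘ
import Data.Rational.Unnormalised.Properties as ℚᵘ
open import Data.Sum.Base as Sum using (_⊎_; inj₁; inj₂; [_,_]′)
open import Function.Base using (_∘_; id)
open import Level using (0ℓ)
open import Relation.Binary.Definitions using (tri<; tri≈; tri>)
open import Relation.Binary.PropositionalEquality using (_≡_; _≢_; refl; sym; trans; cong; cong₂; subst; subst₂; module ≡-Reasoning)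
open import Relation.Nullary using (¬_; Dec; yes; no; does; contradiction)
open import Relation.Nullary.Decidable using (¬?; _×-dec_; _⊎-dec_)
import Relation.Unary as Unary
open import Algebra.Properties.Semiring.Sum ℕ.+-*-semiring
  using (sum; sum-syntax; sum-cong-≗; ∑-distrib-+; ∑-comm; *-distribˡ-sum; *-distribʳ-sum; sum-permute)
open ℚ-arithmetic
open root-properties


-- The counting uses sums of 0-1 indicators in additive form: terms such as -1, -p or -φ(n) are
-- moved to the other side, so truncated subtraction never enters, and differences and halves appear
-- only after the passage to ℚ. The constants of the theorem come from the parts of S: X = p(q - 1)
-- residues divisible by p only, Y = p(p - 1) divisible by q only, and p divisible by both. Here β =
-- 2XY, α is the number of pairs in S that do not join the first part to the second, and |E| = z(n -
-- 1)/2 is half the degree sum. On the analytic side, the operations of `ℝ` act termwise and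
-- integers are constant sequences, so almost every equality holds index by index in ℚ. The
-- exception is √(2k²) = k√2: the m-th term of a square root is rounded down to a multiple of 1/(m +
-- 1), and this rounding does not commute with multiplication by k.

𝟙 : ∀ {P : Set} → Dec P → ℕ
𝟙 P? = if does P? then 1 else 0

module _ {P Q : Set} where

  𝟙-cong : (P? : Dec P) (Q? : Dec Q) → (P → Q) → (Q → P) → 𝟙 P? ≡ 𝟙 Q?
  𝟙-cong (yes _) (yes _) _ _ = refl
  𝟙-cong (yes p) (no ¬q) f _ = contradiction (f p) ¬q
  𝟙-cong (no ¬p) (yes q) _ g = contradiction (g q) ¬p
  𝟙-cong (no _)  (no _)  _ _ = refl

  𝟙-× : (P? : Dec P) (Q? : Dec Q) → 𝟙 (P? ×-dec Q?) ≡ 𝟙 P? ℕ.* 𝟙 Q?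
  𝟙-× (yes _) (yes _) = refl
  𝟙-× (yes _) (no _)  = refl
  𝟙-× (no _)  (yes _) = refl
  𝟙-× (no _)  (no _)  = refl

  𝟙-⊎ : (P? : Dec P) (Q? : Dec Q) → 𝟙 (P? ⊎-dec Q?) ℕ.+ 𝟙 (P? ×-dec Q?) ≡ 𝟙 P? ℕ.+ 𝟙 Q?
  𝟙-⊎ (yes _) (yes _) = refl
  𝟙-⊎ (yes _) (no _)  = refl
  𝟙-⊎ (no _)  (yes _) = refl
  𝟙-⊎ (no _)  (no _)  = refl

𝟙-yes : ∀ {P : Set} (P? : Dec P) → P → 𝟙 P? ≡ 1
𝟙-yes (yes _) _ = refl
𝟙-yes (no ¬p) p = contradiction p ¬p

𝟙-no : ∀ {P : Set} (P? : Dec P) → ¬ P → 𝟙 P? ≡ 0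
𝟙-no (yes p) ¬p = contradiction p ¬p
𝟙-no (no _)  _  = refl

𝟙-¬ : ∀ {P : Set} (P? : Dec P) → 𝟙 P? ℕ.+ 𝟙 (¬? P?) ≡ 1
𝟙-¬ (yes _) = refl
𝟙-¬ (no _)  = refl

𝟙-idem : ∀ {P : Set} (P? : Dec P) → 𝟙 P? ≡ 𝟙 P? ℕ.* 𝟙 P?
𝟙-idem (yes _) = refl
𝟙-idem (no _)  = refl

𝟙-*-¬ : ∀ {P : Set} (P? : Dec P) → 𝟙 P? ℕ.* 𝟙 (¬? P?) ≡ 0
𝟙-*-¬ (yes _) = refl
𝟙-*-¬ (no _)  = refl

-- Sums over `Fin n`

sum-const : ∀ n c → ∑[ i < n ] c ≡ n ℕ.* c
sum-const zero    c = refl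
sum-const (suc n) c = cong (c ℕ.+_) (sum-const n c)

sum-zero : ∀ {n} {f : Fin n → ℕ} → (∀ i → f i ≡ 0) → sum f ≡ 0
sum-zero {n} f≡0 = trans (sum-cong-≗ f≡0) (trans (sum-const n 0) (ℕ.*-zeroʳ n))

∑∑-cong : ∀ {m n} {f g : Fin m → Fin n → ℕ} → (∀ i j → f i j ≡ g i j) →
  ∑[ i < m ] ∑[ j < n ] f i j ≡ ∑[ i < m ] ∑[ j < n ] g i j
∑∑-cong eq = sum-cong-≗ (λ i → sum-cong-≗ (eq i))

∑∑-distrib-+ : ∀ {m n} (f g : Fin m → Fin n → ℕ) →
  ∑[ i < m ] ∑[ j < n ] (f i j ℕ.+ g i j) ≡ ∑[ i < m ] ∑[ j < n ] f i j ℕ.+ ∑[ i < m ] ∑[ j < n ] g i j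
∑∑-distrib-+ f g = trans (sum-cong-≗ (λ i → ∑-distrib-+ (f i) (g i))) (∑-distrib-+ (sum ∘ f) (sum ∘ g))

sum-*-sum : ∀ {m n} (f : Fin m → ℕ) (g : Fin n → ℕ) → ∑[ i < m ] ∑[ j < n ] (f i ℕ.* g j) ≡ sum f ℕ.* sum g
sum-*-sum f g = trans (sum-cong-≗ (λ i → sym (*-distribˡ-sum (f i) g))) (sym (*-distribʳ-sum (sum g) f))

∑-≟ : ∀ {n} (f : Fin n → ℕ) i → ∑[ j < n ] (𝟙 (i Fin.≟ j) ℕ.* f j) ≡ f i
∑-≟ {suc n} f zero    = trans (cong₂ ℕ._+_ (ℕ.*-identityˡ (f zero)) (sum-zero {n} λ _ → refl)) (ℕ.+-identityʳ (f zero))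
∑-≟ {suc n} f (suc i) = trans (sum-cong-≗ step) (∑-≟ (f ∘ suc) i)
  where
  step : ∀ j → 𝟙 (suc i Fin.≟ suc j) ℕ.* f (suc j) ≡ 𝟙 (i Fin.≟ j) ℕ.* f (suc j)
  step j = cong (ℕ._* f (suc j)) (𝟙-cong (suc i Fin.≟ suc j) (i Fin.≟ j) Fin.suc-injective (cong suc))

-- Sums over lists

sumBy : ∀ {A : Set} → (A → ℕ) → List A → ℕ
sumBy f []       = 0
sumBy f (x ∷ xs) = f x ℕ.+ sumBy f xs

sumBy-++ : ∀ {A : Set} (f : A → ℕ) xs ys → sumBy f (xs ++ ys) ≡ sumBy f xs ℕ.+ sumBy f ys
sumBy-++ f []       ys = refl
sumBy-++ f (x ∷ xs) ys = trans (cong (f x ℕ.+_) (sumBy-++ f xs ys)) (sym (ℕ.+-assoc (f x) _ _))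

sumBy-map : ∀ {A B : Set} (f : B → ℕ) (g : A → B) xs → sumBy f (map g xs) ≡ sumBy (f ∘ g) xs
sumBy-map f g []       = refl
sumBy-map f g (x ∷ xs) = cong (f (g x) ℕ.+_) (sumBy-map f g xs)

sumBy-filter : ∀ {A : Set} {P : A → Set} (P? : Unary.Decidable P) (f : A → ℕ) xs →
  sumBy f (filter P? xs) ≡ sumBy (λ x → 𝟙 (P? x) ℕ.* f x) xs
sumBy-filter P? f []       = refl
sumBy-filter P? f (x ∷ xs) with does (P? x)
... | true  = cong₂ ℕ._+_ (sym (ℕ.*-identityˡ (f x))) (sumBy-filter P? f xs)
... | false = sumBy-filter P? f xs

sumBy-tabulate : ∀ {A : Set} {n} (f : A → ℕ) (g : Fin n → A) → sumBy f (tabulate g) ≡ sum (f ∘ g)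
sumBy-tabulate {n = zero}  f g = refl
sumBy-tabulate {n = suc n} f g = cong (f (g zero) ℕ.+_) (sumBy-tabulate f (g ∘ suc))

sumBy-allFin : ∀ {n} (f : Fin n → ℕ) → sumBy f (allFin n) ≡ sum f
sumBy-allFin f = sumBy-tabulate f id

sumBy-cartesianProduct : ∀ {A B : Set} (f : A × B → ℕ) xs ys →
  sumBy f (cartesianProduct xs ys) ≡ sumBy (λ x → sumBy (λ y → f (x , y)) ys) xs
sumBy-cartesianProduct f []       ys = refl
sumBy-cartesianProduct f (x ∷ xs) ys =
  trans (sumBy-++ f (map (x ,_) ys) (cartesianProduct xs ys))
    (cong₂ ℕ._+_ (sumBy-map f (x ,_) ys) (sumBy-cartesianProduct f xs ys))

length-filter-sumBy : ∀ {A : Set} {P : A → Set} (P? : Unary.Decidable P) xs →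
  length (filter P? xs) ≡ sumBy (𝟙 ∘ P?) xs
length-filter-sumBy P? []       = refl
length-filter-sumBy P? (x ∷ xs) with does (P? x)
... | true  = cong suc (length-filter-sumBy P? xs)
... | false = length-filter-sumBy P? xs

-- Sums over the edges of a graph

module EdgeSums {n : ℕ} (G : SimpleGraph n) where
  open SimpleGraph G

  adj : Fin n → Fin n → ℕ
  adj u v = 𝟙 (adj? u v)

  adj-comm : ∀ u v → adj u v ≡ adj v u
  adj-comm u v = 𝟙-cong (adj? u v) (adj? v u) adj-sym adj-sym

  adj-diagonal : ∀ u → adj u u ≡ 0
  adj-diagonal u = 𝟙-no (adj? u u) (adj-irrefl refl)

  degree-sum : ∀ u → degree u ≡ ∑[ v < n ] adj u v
  degree-sum u = trans (length-filter-sumBy (adj? u) (allFin n)) (sumBy-allFin (adj u))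

  -- `edges` covers the adjacent pairs with u < v. Exchanging the two summations covers those with v
  -- < u, and the diagonal contributes nothing because no vertex is adjacent to itself.
  edges-double : ∀ (f : Fin n → Fin n → ℕ) → (∀ u v → f u v ≡ f v u) →
    2 ℕ.* sumBy (λ (u , v) → f u v) edges ≡ ∑[ u < n ] ∑[ v < n ] (adj u v ℕ.* f u v)
  edges-double f f-comm = begin
    2 ℕ.* sumBy (λ (u , v) → f u v) edges
      ≡⟨ cong (2 ℕ.*_) ordered ⟩
    2 ℕ.* ∑[ u < n ] ∑[ v < n ] below u v
      ≡⟨ cong (∑[ u < n ] ∑[ v < n ] below u v ℕ.+_) (ℕ.+-identityʳ _) ⟩
    ∑[ u < n ] ∑[ v < n ] below u v ℕ.+ ∑[ u < n ] ∑[ v < n ] below u v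
      ≡⟨ cong (∑[ u < n ] ∑[ v < n ] below u v ℕ.+_) (∑-comm below) ⟩
    ∑[ u < n ] ∑[ v < n ] below u v ℕ.+ ∑[ u < n ] ∑[ v < n ] below v u
      ≡⟨ ∑∑-distrib-+ below (λ u v → below v u) ⟨
    ∑[ u < n ] ∑[ v < n ] (below u v ℕ.+ below v u)
      ≡⟨ ∑∑-cong either ⟩
    ∑[ u < n ] ∑[ v < n ] (adj u v ℕ.* f u v) ∎
    where
    open ≡-Reasoning

    below : Fin n → Fin n → ℕ
    below u v = 𝟙 (u Fin.<? v) ℕ.* adj u v ℕ.* f u v

    weighted : Fin n × Fin n → ℕ
    weighted (u , v) = 𝟙 ((u Fin.<? v) ×-dec adj? u v) ℕ.* f u v

    ordered : sumBy (λ (u , v) → f u v) edges ≡ ∑[ u < n ] ∑[ v < n ] below u v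
    ordered = begin
      sumBy (λ (u , v) → f u v) edges
        ≡⟨ sumBy-filter (λ (u , v) → (u Fin.<? v) ×-dec adj? u v) (λ (u , v) → f u v) (cartesianProduct (allFin n) (allFin n)) ⟩
      sumBy weighted (cartesianProduct (allFin n) (allFin n))
        ≡⟨ sumBy-cartesianProduct weighted (allFin n) (allFin n) ⟩
      sumBy (λ u → sumBy (λ v → weighted (u , v)) (allFin n)) (allFin n)
        ≡⟨ sumBy-allFin (λ u → sumBy (λ v → weighted (u , v)) (allFin n)) ⟩
      ∑[ u < n ] sumBy (λ v → weighted (u , v)) (allFin n)
        ≡⟨ sum-cong-≗ (λ u → sumBy-allFin (λ v → weighted (u , v))) ⟩
      ∑[ u < n ] ∑[ v < n ] weighted (u , v)
        ≡⟨ ∑∑-cong (λ u v → cong (ℕ._* f u v) (𝟙-× (u Fin.<? v) (adj? u v))) ⟩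
      ∑[ u < n ] ∑[ v < n ] below u v ∎

    either : ∀ u v → below u v ℕ.+ below v u ≡ adj u v ℕ.* f u v
    either u v rewrite f-comm v u | adj-comm v u with ℕ.<-cmp (toℕ u) (toℕ v)
    ... | tri< u<v _ v≮u rewrite 𝟙-yes (u Fin.<? v) u<v | 𝟙-no (v Fin.<? u) v≮u =
          trans (ℕ.+-identityʳ _) (cong (ℕ._* f u v) (ℕ.*-identityˡ (adj u v)))
    ... | tri> u≮v _ v<u rewrite 𝟙-no (u Fin.<? v) u≮v | 𝟙-yes (v Fin.<? u) v<u =
          cong (ℕ._* f u v) (ℕ.*-identityˡ (adj u v))
    ... | tri≈ _ u≡v _ with refl ← Fin.toℕ-injective u≡v rewrite adj-diagonal u =
          cong₂ (λ a b → a ℕ.* f u u ℕ.+ b ℕ.* f u u) (ℕ.*-zeroʳ (𝟙 (u Fin.<? u))) (ℕ.*-zeroʳ (𝟙 (u Fin.<? u)))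

-- Divisibility by p or q below p²q

∑-splitAt : ∀ m n (f : ℕ → ℕ) →
  ∑[ i < m ℕ.+ n ] f (toℕ i) ≡ ∑[ i < m ] f (toℕ i) ℕ.+ ∑[ i < n ] f (m ℕ.+ toℕ i)
∑-splitAt zero    n f = refl
∑-splitAt (suc m) n f = trans (cong (f 0 ℕ.+_) (∑-splitAt m n (f ∘ suc))) (sym (ℕ.+-assoc (f 0) _ _))

-- Needed because `φ` counts over 1, ..., n while sums over `Fin n` run over 0, ..., n - 1. With
-- `f 0` added, both sides become the sum over 0, ..., n.
∑-rotate : ∀ n (f : ℕ → ℕ) → f n ≡ f 0 → ∑[ i < n ] f (suc (toℕ i)) ≡ ∑[ i < n ] f (toℕ i)
∑-rotate n f fn≡f0 = ℕ.+-cancelˡ-≡ (f 0) _ _ (begin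
  f 0 ℕ.+ ∑[ i < n ] f (suc (toℕ i))           ≡⟨ cong (λ m → ∑[ i < m ] f (toℕ i)) (ℕ.+-comm 1 n) ⟩
  ∑[ i < n ℕ.+ 1 ] f (toℕ i)                   ≡⟨ ∑-splitAt n 1 f ⟩
  ∑[ i < n ] f (toℕ i) ℕ.+ (f (n ℕ.+ 0) ℕ.+ 0) ≡⟨ cong (∑[ i < n ] f (toℕ i) ℕ.+_) last ⟩
  ∑[ i < n ] f (toℕ i) ℕ.+ f n                 ≡⟨ ℕ.+-comm _ (f n) ⟩
  f n ℕ.+ ∑[ i < n ] f (toℕ i)                 ≡⟨ cong (ℕ._+ ∑[ i < n ] f (toℕ i)) fn≡f0 ⟩
  f 0 ℕ.+ ∑[ i < n ] f (toℕ i)                 ∎)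
  where
  open ≡-Reasoning
  last : f (n ℕ.+ 0) ℕ.+ 0 ≡ f n
  last = trans (ℕ.+-identityʳ _) (cong f (ℕ.+-identityʳ n))

∑-multiples-period : ∀ d .{{_ : ℕ.NonZero d}} → ∑[ i < d ] 𝟙 (d ∣? toℕ i) ≡ 1
∑-multiples-period (suc d) = cong₂ ℕ._+_ (𝟙-yes (suc d ∣? 0) (suc d ∣0))
  (sum-zero {d} λ i → 𝟙-no (suc d ∣? suc (toℕ i)) λ d∣i → ℕ.<⇒≱ (ℕ.s≤s (Fin.toℕ<n i)) (∣⇒≤ d∣i))

-- The range splits into m blocks of length d, each starting at a multiple of d and containing no
-- other.
∑-multiples : ∀ m d .{{_ : ℕ.NonZero d}} → ∑[ i < m ℕ.* d ] 𝟙 (d ∣? toℕ i) ≡ m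
∑-multiples zero    d = refl
∑-multiples (suc m) d = begin
  ∑[ i < d ℕ.+ m ℕ.* d ] 𝟙 (d ∣? toℕ i)
    ≡⟨ ∑-splitAt d (m ℕ.* d) (λ k → 𝟙 (d ∣? k)) ⟩
  ∑[ i < d ] 𝟙 (d ∣? toℕ i) ℕ.+ ∑[ i < m ℕ.* d ] 𝟙 (d ∣? (d ℕ.+ toℕ i))
    ≡⟨ cong₂ ℕ._+_ (∑-multiples-period d) (trans (sum-cong-≗ {m ℕ.* d} shift) (∑-multiples m d)) ⟩
  suc m ∎
  where
  open ≡-Reasoning
  shift : ∀ i → 𝟙 (d ∣? (d ℕ.+ toℕ i)) ≡ 𝟙 (d ∣? toℕ i)
  shift i = 𝟙-cong (d ∣? (d ℕ.+ toℕ i)) (d ∣? toℕ i) (λ e → ∣m+n∣m⇒∣n e ∣-refl) (∣m∣n⇒∣m+n ∣-refl)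

sumBy-applyUpTo : ∀ {A : Set} (f : A → ℕ) (g : ℕ → A) n → sumBy f (applyUpTo g n) ≡ ∑[ i < n ] f (g (toℕ i))
sumBy-applyUpTo f g zero    = refl
sumBy-applyUpTo f g (suc n) = cong (f (g 0) ℕ.+_) (sumBy-applyUpTo f (g ∘ suc) n)

coprime-* : ∀ {k m n} → Coprime k m → Coprime k n → Coprime k (m ℕ.* n)
coprime-* c c′ (d∣k , d∣m*n) =
  c′ (d∣k , coprime-divisor (λ (e∣d , e∣m) → c (∣-trans e∣d d∣k , e∣m)) d∣m*n)

prime∤⇒coprime : ∀ {p k} → Prime p → ¬ (p ∣ k) → Coprime k p
prime∤⇒coprime p-prime p∤k (d∣k , d∣p) with prime⇒irreducible p-prime d∣p
... | inj₁ d≡1 = d≡1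
... | inj₂ refl = contradiction d∣k p∤k

prime≢1 : ∀ {p} → Prime p → p ≢ 1
prime≢1 p-prime = ℕ.nonTrivial⇒≢1 {{prime⇒nonTrivial p-prime}}

distinct-primes⇒coprime : ∀ {p q} → Prime p → Prime q → p ≢ q → Coprime p q
distinct-primes⇒coprime p-prime q-prime p≢q = prime∤⇒coprime q-prime λ q∣p →
  [ prime≢1 q-prime , p≢q ∘ sym ]′ (prime⇒irreducible p-prime q∣p)

coprime-*-∣ : ∀ {m n k} → Coprime m n → m ∣ k → n ∣ k → m ℕ.* n ∣ k
coprime-*-∣ {m} {n} c (divides a refl) n∣k =
  subst (m ℕ.* n ∣_) (ℕ.*-comm m a) (*-monoʳ-∣ m (coprime-divisor (coprime-sym c) (subst (n ∣_) (ℕ.*-comm a m) n∣k)))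

∑-⊎ : ∀ {n} {P Q : Fin n → Set} (P? : Unary.Decidable P) (Q? : Unary.Decidable Q) →
  ∑[ i < n ] 𝟙 (P? i ⊎-dec Q? i) ℕ.+ ∑[ i < n ] 𝟙 (P? i ×-dec Q? i) ≡ ∑[ i < n ] 𝟙 (P? i) ℕ.+ ∑[ i < n ] 𝟙 (Q? i)
∑-⊎ {n} P? Q? = trans (sym (∑-distrib-+ {n} _ _)) (trans (sum-cong-≗ {n} (λ i → 𝟙-⊎ (P? i) (Q? i))) (∑-distrib-+ {n} _ _))

∑-∖ : ∀ {n} {P Q : Fin n → Set} (P? : Unary.Decidable P) (Q? : Unary.Decidable Q) →
  ∑[ i < n ] 𝟙 (P? i ×-dec ¬? (Q? i)) ℕ.+ ∑[ i < n ] 𝟙 (P? i ×-dec Q? i) ≡ ∑[ i < n ] 𝟙 (P? i)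
∑-∖ {n} P? Q? = trans (sym (∑-distrib-+ {n} _ _)) (sum-cong-≗ {n} (λ i → split (P? i) (Q? i)))
  where
  split : ∀ {P Q : Set} (P? : Dec P) (Q? : Dec Q) → 𝟙 (P? ×-dec ¬? Q?) ℕ.+ 𝟙 (P? ×-dec Q?) ≡ 𝟙 P?
  split (yes _) (yes _) = refl
  split (yes _) (no _)  = refl
  split (no _)  (yes _) = refl
  split (no _)  (no _)  = refl

module P²Q {p q : ℕ} (p-prime : Prime p) (q-prime : Prime q) (p≢q : p ≢ q) where

  private instance
    p≢0 : ℕ.NonZero p
    p≢0 = prime⇒nonZero p-prime
    q≢0 : ℕ.NonZero q
    q≢0 = prime⇒nonZero q-prime
    pq≢0 : ℕ.NonZero (p ℕ.* q)
    pq≢0 = ℕ.m*n≢0 p q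

  n : ℕ
  n = p ^ 2 ℕ.* q

  p⊥q : Coprime p q
  p⊥q = distinct-primes⇒coprime p-prime q-prime p≢q

  -- This factorisation and `n-as-q` serve twice: the first factor is the number of residues
  -- divisible by the last one, and it also annihilates those residues modulo n.
  n-as-p : n ≡ (p ℕ.* q) ℕ.* p
  n-as-p = identity p q
    where
    identity : ∀ p q → p ℕ.* (p ℕ.* 1) ℕ.* q ≡ (p ℕ.* q) ℕ.* p
    identity = solve-∀

  n-as-q : n ≡ (p ℕ.* p) ℕ.* q
  n-as-q = identity p q
    where
    identity : ∀ p q → p ℕ.* (p ℕ.* 1) ℕ.* q ≡ (p ℕ.* p) ℕ.* q
    identity = solve-∀

  n-as-pq : n ≡ p ℕ.* (p ℕ.* q)
  n-as-pq = trans n-as-p (ℕ.*-comm (p ℕ.* q) p)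

  p∣n : p ∣ n
  p∣n = divides (p ℕ.* q) n-as-p

  q∣n : q ∣ n
  q∣n = divides (p ℕ.* p) n-as-q

  -- Failure of coprimality to n, put as two divisibilities: these can be counted by
  -- inclusion-exclusion and are preserved by reduction modulo n.
  Shares : ℕ → Set
  Shares k = p ∣ k ⊎ q ∣ k

  shares? : Unary.Decidable Shares
  shares? k = (p ∣? k) ⊎-dec (q ∣? k)

  coprime⇒¬shares : ∀ {k} → Coprime k n → ¬ Shares k
  coprime⇒¬shares c (inj₁ p∣k) = prime≢1 p-prime (c (p∣k , p∣n))
  coprime⇒¬shares c (inj₂ q∣k) = prime≢1 q-prime (c (q∣k , q∣n))

  ¬shares⇒coprime : ∀ {k} → ¬ Shares k → Coprime k n
  ¬shares⇒coprime {k} ¬s = subst (Coprime k) (sym n-as-pq) (coprime-* k⊥p (coprime-* k⊥p k⊥q))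
    where
    k⊥p = prime∤⇒coprime p-prime (¬s ∘ inj₁)
    k⊥q = prime∤⇒coprime q-prime (¬s ∘ inj₂)

  z : ℕ
  z = ∑[ i < n ] 𝟙 (shares? (toℕ i))

  φ+z≡n : φ n ℕ.+ z ≡ n
  φ+z≡n = begin
    φ n ℕ.+ z
      ≡⟨ cong (ℕ._+ z) φ-as-∑ ⟩
    ∑[ i < n ] 𝟙 (coprime? (toℕ i) n) ℕ.+ z
      ≡⟨ ∑-distrib-+ {n} (λ i → 𝟙 (coprime? (toℕ i) n)) (λ i → 𝟙 (shares? (toℕ i))) ⟨
    ∑[ i < n ] (𝟙 (coprime? (toℕ i) n) ℕ.+ 𝟙 (shares? (toℕ i)))
      ≡⟨ sum-cong-≗ {n} (λ i → complementary (toℕ i)) ⟩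
    ∑[ i < n ] 1
      ≡⟨ trans (sum-const n 1) (ℕ.*-identityʳ n) ⟩
    n ∎
    where
    open ≡-Reasoning
    complementary : ∀ k → 𝟙 (coprime? k n) ℕ.+ 𝟙 (shares? k) ≡ 1
    complementary k = trans
      (cong (ℕ._+ 𝟙 (shares? k)) (𝟙-cong (coprime? k n) (¬? (shares? k)) coprime⇒¬shares ¬shares⇒coprime))
      (trans (ℕ.+-comm _ (𝟙 (shares? k))) (𝟙-¬ (shares? k)))
    -- `∑-rotate` asks for equal values at 0 and n, and gcd(0, n) = n = gcd(n, n).
    0~n : 𝟙 (coprime? n n) ≡ 𝟙 (coprime? 0 n)
    0~n = 𝟙-cong (coprime? n n) (coprime? 0 n)
      (λ c (_ , d∣n) → c (d∣n , d∣n)) (λ c (_ , d∣n) → c (_ ∣0 , d∣n))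
    φ-as-∑ : φ n ≡ ∑[ i < n ] 𝟙 (coprime? (toℕ i) n)
    φ-as-∑ = begin
      φ n                                               ≡⟨ length-filter-sumBy (λ k → coprime? k n) (map suc (upTo n)) ⟩
      sumBy (λ k → 𝟙 (coprime? k n)) (map suc (upTo n)) ≡⟨ sumBy-map (λ k → 𝟙 (coprime? k n)) suc (upTo n) ⟩
      sumBy (λ k → 𝟙 (coprime? (suc k) n)) (upTo n)     ≡⟨ sumBy-applyUpTo (λ k → 𝟙 (coprime? (suc k) n)) id n ⟩
      ∑[ i < n ] 𝟙 (coprime? (suc (toℕ i)) n)           ≡⟨ ∑-rotate n (λ k → 𝟙 (coprime? k n)) 0~n ⟩
      ∑[ i < n ] 𝟙 (coprime? (toℕ i) n)                 ∎

  ∑-p∣ : ∑[ i < n ] 𝟙 (p ∣? toℕ i) ≡ p ℕ.* q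
  ∑-p∣ = trans (cong (λ m → ∑[ i < m ] 𝟙 (p ∣? toℕ i)) n-as-p) (∑-multiples (p ℕ.* q) p)

  ∑-q∣ : ∑[ i < n ] 𝟙 (q ∣? toℕ i) ≡ p ℕ.* p
  ∑-q∣ = trans (cong (λ m → ∑[ i < m ] 𝟙 (q ∣? toℕ i)) n-as-q) (∑-multiples (p ℕ.* p) q)

  ∑-p∣×q∣ : ∑[ i < n ] 𝟙 ((p ∣? toℕ i) ×-dec (q ∣? toℕ i)) ≡ p
  ∑-p∣×q∣ = begin
    ∑[ i < n ] 𝟙 ((p ∣? toℕ i) ×-dec (q ∣? toℕ i))  ≡⟨ sum-cong-≗ {n} (λ i → pq∣ (toℕ i)) ⟩
    ∑[ i < n ] 𝟙 ((p ℕ.* q) ∣? toℕ i)               ≡⟨ cong (λ m → ∑[ i < m ] 𝟙 ((p ℕ.* q) ∣? toℕ i)) n-as-pq ⟩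
    ∑[ i < p ℕ.* (p ℕ.* q) ] 𝟙 ((p ℕ.* q) ∣? toℕ i) ≡⟨ ∑-multiples p (p ℕ.* q) ⟩
    p                                              ∎
    where
    open ≡-Reasoning
    pq∣ : ∀ k → 𝟙 ((p ∣? k) ×-dec (q ∣? k)) ≡ 𝟙 ((p ℕ.* q) ∣? k)
    pq∣ k = 𝟙-cong ((p ∣? k) ×-dec (q ∣? k)) ((p ℕ.* q) ∣? k)
      (λ (p∣k , q∣k) → coprime-*-∣ p⊥q p∣k q∣k)
      (λ pq∣k → m*n∣⇒m∣ p q pq∣k , m*n∣⇒n∣ p q pq∣k)

  onlyP onlyQ : ℕ → ℕ
  onlyP k = 𝟙 ((p ∣? k) ×-dec ¬? (q ∣? k))
  onlyQ k = 𝟙 ((q ∣? k) ×-dec ¬? (p ∣? k))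

  z-value : z ℕ.+ p ≡ p ℕ.* q ℕ.+ p ℕ.* p
  z-value = begin
    z ℕ.+ p                                                 ≡⟨ cong (z ℕ.+_) ∑-p∣×q∣ ⟨
    z ℕ.+ ∑[ i < n ] 𝟙 ((p ∣? toℕ i) ×-dec (q ∣? toℕ i))    ≡⟨ ∑-⊎ {n} (λ i → p ∣? toℕ i) (λ i → q ∣? toℕ i) ⟩
    ∑[ i < n ] 𝟙 (p ∣? toℕ i) ℕ.+ ∑[ i < n ] 𝟙 (q ∣? toℕ i) ≡⟨ cong₂ ℕ._+_ ∑-p∣ ∑-q∣ ⟩
    p ℕ.* q ℕ.+ p ℕ.* p                                     ∎
    where open ≡-Reasoning

  -- This and `onlyQ-count` are the source of the numbers p(q - 1) and p(p - 1) in α and β.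
  onlyP-count : ∑[ i < n ] onlyP (toℕ i) ℕ.+ p ≡ p ℕ.* q
  onlyP-count = trans (cong (∑[ i < n ] onlyP (toℕ i) ℕ.+_) (sym ∑-p∣×q∣))
    (trans (∑-∖ {n} (λ i → p ∣? toℕ i) (λ i → q ∣? toℕ i)) ∑-p∣)

  onlyQ-count : ∑[ i < n ] onlyQ (toℕ i) ℕ.+ p ≡ p ℕ.* p
  onlyQ-count = trans (cong (∑[ i < n ] onlyQ (toℕ i) ℕ.+_) (sym (trans (sum-cong-≗ {n} (λ i → swap (toℕ i))) ∑-p∣×q∣)))
    (trans (∑-∖ {n} (λ i → q ∣? toℕ i) (λ i → p ∣? toℕ i)) ∑-q∣)
    where
    swap : ∀ k → 𝟙 ((q ∣? k) ×-dec (p ∣? k)) ≡ 𝟙 ((p ∣? k) ×-dec (q ∣? k))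
    swap k = 𝟙-cong ((q ∣? k) ×-dec (p ∣? k)) ((p ∣? k) ×-dec (q ∣? k)) (λ (a , b) → b , a) (λ (a , b) → b , a)

  private
    ∣+-∤ : ∀ {d k l} → d ∣ k → ¬ (d ∣ l) → ¬ (d ∣ k ℕ.+ l)
    ∣+-∤ d∣k d∤l d∣k+l = d∤l (∣m+n∣m⇒∣n d∣k+l d∣k)

    +∣-∤ : ∀ {d k l} → d ∣ l → ¬ (d ∣ k) → ¬ (d ∣ k ℕ.+ l)
    +∣-∤ {d} {k} {l} d∣l d∤k d∣k+l = ∣+-∤ d∣l d∤k (subst (d ∣_) (ℕ.+-comm k l) d∣k+l)

    -- The factor `1 ℕ.* 1` is what the indicators of the two summands reduce to in `shares-+` after
    -- the four divisibility tests have been split.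
    vanish : ∀ {m} → Shares m → 1 ℕ.* 1 ℕ.* 𝟙 (¬? (shares? m)) ≡ 0
    vanish {m} s = cong (1 ℕ.* 1 ℕ.*_) (𝟙-no (¬? (shares? m)) (λ ¬s → ¬s s))

    remain : ∀ {m} → ¬ (p ∣ m) → ¬ (q ∣ m) → 1 ℕ.* 1 ℕ.* 𝟙 (¬? (shares? m)) ≡ 1
    remain {m} p∤m q∤m = cong (1 ℕ.* 1 ℕ.*_) (𝟙-yes (¬? (shares? m)) [ p∤m , q∤m ]′)

  -- A sum of two elements divisible by p or q is divisible by neither exactly
  -- when one of them is divisible by p only and the other by q only.
  shares-+ : ∀ k l → 𝟙 (shares? k) ℕ.* 𝟙 (shares? l) ℕ.* 𝟙 (¬? (shares? (k ℕ.+ l))) ≡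
    onlyP k ℕ.* onlyQ l ℕ.+ onlyQ k ℕ.* onlyP l
  shares-+ k l with p ∣? k | q ∣? k | p ∣? l | q ∣? l
  ... | no _    | no _    | _       | _       = refl
  ... | yes _   | yes _   | no _    | no _    = refl
  ... | yes _   | no _    | no _    | no _    = refl
  ... | no _    | yes _   | no _    | no _    = refl
  ... | yes p∣k | no _    | yes p∣l | no _    = vanish (inj₁ (∣m∣n⇒∣m+n p∣k p∣l))
  ... | yes p∣k | no _    | yes p∣l | yes _   = vanish (inj₁ (∣m∣n⇒∣m+n p∣k p∣l))
  ... | yes p∣k | yes _   | yes p∣l | no _    = vanish (inj₁ (∣m∣n⇒∣m+n p∣k p∣l))
  ... | yes p∣k | yes _   | yes p∣l | yes _   = vanish (inj₁ (∣m∣n⇒∣m+n p∣k p∣l))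
  ... | no _    | yes q∣k | no _    | yes q∣l = vanish (inj₂ (∣m∣n⇒∣m+n q∣k q∣l))
  ... | no _    | yes q∣k | yes _   | yes q∣l = vanish (inj₂ (∣m∣n⇒∣m+n q∣k q∣l))
  ... | yes _   | yes q∣k | no _    | yes q∣l = vanish (inj₂ (∣m∣n⇒∣m+n q∣k q∣l))
  ... | yes p∣k | no q∤k  | no p∤l  | yes q∣l = remain (∣+-∤ p∣k p∤l) (+∣-∤ q∣l q∤k)
  ... | no p∤k  | yes q∣k | yes p∣l | no q∤l  = remain (+∣-∤ p∣l p∤k) (∣+-∤ q∣k q∤l)

-- The total graph

module ZeroDivisors (n : ℕ) .{{_ : ℕ.NonZero n}} where
  open ℤmod n

  ring : CommutativeRing 0ℓ 0ℓ
  ring = record { isCommutativeRing = ℤ/ n }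

  ∣-[]⁻ : ∀ {d} k → d ∣ n → d ∣ toℕ [ k ] → d ∣ k
  ∣-[]⁻ {d} k d∣n d∣[k] = ∣n∣m%n⇒∣m d∣n (subst (d ∣_) (toℕ-[] k) d∣[k])

  ∣-[]⁺ : ∀ {d} k → d ∣ n → d ∣ k → d ∣ toℕ [ k ]
  ∣-[]⁺ {d} k d∣n d∣k = subst (d ∣_) (sym (toℕ-[] k)) (%-presˡ-∣ d∣k d∣n)

  toℕ[0] : toℕ [ 0 ] ≡ 0
  toℕ[0] = trans (toℕ-[] 0) (ℕ.m*n%n≡0 0 n)

  []≡0⇒∣ : ∀ {k} → [ k ] ≡ [ 0 ] → n ∣ k
  []≡0⇒∣ {k} eq = ∣-[]⁻ k ∣-refl (subst (n ∣_) (sym (trans (cong toℕ eq) toℕ[0])) (n ∣0))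

  ∣⇒[]≡0 : ∀ {k} → n ∣ k → [ k ] ≡ [ 0 ]
  ∣⇒[]≡0 {k} n∣k = []-cong (trans (n∣m⇒m%n≡0 k n n∣k) (sym (ℕ.m*n%n≡0 0 n)))

  -- The cofactor m annihilates x, since m · x is a multiple of m · d = n, and 0 < m < n keeps
  -- `[ m ]` nonzero.
  divisor⇒zeroDivisor : ∀ {m d} .{{_ : ℕ.NonZero m}} .{{_ : ℕ.NonTrivial d}} → n ≡ m ℕ.* d →
    ∀ x → d ∣ toℕ x → IsZeroDivisor ring x
  divisor⇒zeroDivisor {m} {d} n≡m*d x d∣x = inj₂ ([ m ] ,
    (λ [m]≡0 → ℕ.<⇒≱ (subst (m <_) (sym n≡m*d) (ℕ.m<m*n m d (ℕ.nonTrivial⇒n>1 d))) (∣⇒≤ ([]≡0⇒∣ [m]≡0))) ,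
    trans (⊗-comm x [ m ]) (trans (⊗-homoˡ m x)
      (∣⇒[]≡0 (subst (_∣ m ℕ.* toℕ x) (sym n≡m*d) (*-monoʳ-∣ m d∣x)))))

  ⊕-permutation : Fin n → Permutation n n
  ⊕-permutation u = permutation (u ⊕_) ((⊖ u) ⊕_)
    (λ y → trans (sym (⊕-assoc u (⊖ u) y)) (trans (cong (_⊕ y) (trans (⊕-comm u (⊖ u)) (⊖-inverseˡ u))) (⊕-identityˡ y)))
    (λ y → trans (sym (⊕-assoc (⊖ u) u y)) (trans (cong (_⊕ y) (⊖-inverseˡ u)) (⊕-identityˡ y)))

  ∑-translate : ∀ (f : Fin n → ℕ) u → ∑[ v < n ] f (u ⊕ v) ≡ ∑[ v < n ] f v
  ∑-translate f u = sym (sum-permute f (⊕-permutation u))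

-- Edge counts in a graph with two degree classes

module TwoClasses {n : ℕ} (G : SimpleGraph n) {S : Fin n → Set} (S? : Unary.Decidable S)
  (z : ℕ) (degree+S : ∀ u → SimpleGraph.degree G u ℕ.+ 𝟙 (S? u) ≡ z) (∑-S : ∑[ u < n ] 𝟙 (S? u) ≡ z) where

  open SimpleGraph G
  open EdgeSums G

  w w̄ : Fin n → ℕ
  w x = 𝟙 (S? x)
  w̄ x = 𝟙 (¬? (S? x))

  w+w̄ : ∀ x → w x ℕ.+ w̄ x ≡ 1
  w+w̄ x = 𝟙-¬ (S? x)

  -- Ordered pairs are used because double sums factor over them. An edge inside a class is met
  -- twice and an edge between the classes once, hence the factor 2 for `#both` and `#neither` but
  -- not for `#mixed`.
  ordered : (Fin n → ℕ) → (Fin n → ℕ) → ℕ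
  ordered f g = ∑[ u < n ] ∑[ v < n ] (adj u v ℕ.* (f u ℕ.* g v))

  ordered-comm : ∀ f g → ordered f g ≡ ordered g f
  ordered-comm f g = trans (∑-comm {n} {n} (λ u v → adj u v ℕ.* (f u ℕ.* g v)))
    (∑∑-cong {n} {n} λ v u → cong₂ ℕ._*_ (adj-comm u v) (ℕ.*-comm (f u) (g v)))

  -- As `w` and `w̄` add up to 1, the weight of the second vertex disappears and the inner sum
  -- counts all neighbours of u.
  ordered-degree : ∀ f → ordered f w ℕ.+ ordered f w̄ ≡ ∑[ u < n ] (f u ℕ.* degree u)
  ordered-degree f = begin
    ordered f w ℕ.+ ordered f w̄
      ≡⟨ ∑∑-distrib-+ {n} {n} (λ u v → adj u v ℕ.* (f u ℕ.* w v)) (λ u v → adj u v ℕ.* (f u ℕ.* w̄ v)) ⟨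
    ∑[ u < n ] ∑[ v < n ] (adj u v ℕ.* (f u ℕ.* w v) ℕ.+ adj u v ℕ.* (f u ℕ.* w̄ v))
      ≡⟨ ∑∑-cong {n} {n} (λ u v → trans (factor (adj u v) (f u) (w v) (w̄ v))
           (trans (cong (f u ℕ.* adj u v ℕ.*_) (w+w̄ v)) (ℕ.*-identityʳ _))) ⟩
    ∑[ u < n ] ∑[ v < n ] (f u ℕ.* adj u v)
      ≡⟨ sum-cong-≗ {n} (λ u → sym (*-distribˡ-sum {n} (f u) (adj u))) ⟩
    ∑[ u < n ] (f u ℕ.* ∑[ v < n ] adj u v)
      ≡⟨ sum-cong-≗ {n} (λ u → cong (f u ℕ.*_) (sym (degree-sum u))) ⟩
    ∑[ u < n ] (f u ℕ.* degree u) ∎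
    where
    open ≡-Reasoning
    factor : ∀ a x y z → a ℕ.* (x ℕ.* y) ℕ.+ a ℕ.* (x ℕ.* z) ≡ x ℕ.* a ℕ.* (y ℕ.+ z)
    factor = solve-∀

  ∑-w-degree : ∑[ u < n ] (w u ℕ.* degree u) ℕ.+ z ≡ z ℕ.* z
  ∑-w-degree = begin
    ∑[ u < n ] (w u ℕ.* degree u) ℕ.+ z
      ≡⟨ trans (∑-distrib-+ {n} (λ u → w u ℕ.* degree u) w) (cong (∑[ u < n ] (w u ℕ.* degree u) ℕ.+_) ∑-S) ⟨
    ∑[ u < n ] (w u ℕ.* degree u ℕ.+ w u)
      ≡⟨ sum-cong-≗ {n} step ⟩
    ∑[ u < n ] (w u ℕ.* z)
      ≡⟨ trans (cong (ℕ._* z) (sym ∑-S)) (*-distribʳ-sum {n} z w) ⟨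
    z ℕ.* z ∎
    where
    open ≡-Reasoning
    step : ∀ u → w u ℕ.* degree u ℕ.+ w u ≡ w u ℕ.* z
    -- An indicator equals its square, so the added `w u` becomes `w u ℕ.* w u` and completes the
    -- degree to z.
    step u = trans (cong (w u ℕ.* degree u ℕ.+_) (𝟙-idem (S? u)))
      (trans (sym (ℕ.*-distribˡ-+ (w u) (degree u) (w u))) (cong (w u ℕ.*_) (degree+S u)))

  z̄ : ℕ
  z̄ = ∑[ u < n ] w̄ u

  z+z̄≡n : z ℕ.+ z̄ ≡ n
  z+z̄≡n = trans (cong (ℕ._+ z̄) (sym ∑-S))
    (trans (sym (∑-distrib-+ {n} w w̄)) (trans (sum-cong-≗ {n} w+w̄) (trans (sum-const n 1) (ℕ.*-identityʳ n))))

  w*w̄ : ∀ u → w u ℕ.* w̄ u ≡ 0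
  w*w̄ u = 𝟙-*-¬ (S? u)

  ∑-w̄-degree : ∑[ u < n ] (w̄ u ℕ.* degree u) ≡ z̄ ℕ.* z
  ∑-w̄-degree = trans (sum-cong-≗ {n} step) (sym (*-distribʳ-sum {n} z w̄))
    where
    open ≡-Reasoning
    step : ∀ u → w̄ u ℕ.* degree u ≡ w̄ u ℕ.* z
    step u = begin
      w̄ u ℕ.* degree u                  ≡⟨ ℕ.+-identityʳ _ ⟨
      -- The 0 is written as `w̄ u ℕ.* w u`, again to complete the degree to z.
      w̄ u ℕ.* degree u ℕ.+ 0            ≡⟨ cong (w̄ u ℕ.* degree u ℕ.+_) (trans (sym (w*w̄ u)) (ℕ.*-comm (w u) (w̄ u))) ⟩
      w̄ u ℕ.* degree u ℕ.+ w̄ u ℕ.* w u ≡⟨ ℕ.*-distribˡ-+ (w̄ u) (degree u) (w u) ⟨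
      w̄ u ℕ.* (degree u ℕ.+ w u)        ≡⟨ cong (w̄ u ℕ.*_) (degree+S u) ⟩
      w̄ u ℕ.* z                         ∎

  -- Edges are stored with the smaller endpoint first, so the endpoint in S may be either component.
  -- `mixed` allows both orders, which gives the symmetry that `edges-double` requires.
  both mixed neither : Fin n × Fin n → ℕ
  both    (u , v) = w u ℕ.* w v
  mixed   (u , v) = w u ℕ.* w̄ v ℕ.+ w̄ u ℕ.* w v
  neither (u , v) = w̄ u ℕ.* w̄ v

  #both #mixed #neither : ℕ
  #both    = sumBy both edges
  #mixed   = sumBy mixed edges
  #neither = sumBy neither edges

  2#both : 2 ℕ.* #both ≡ ordered w w
  2#both = edges-double (λ u v → both (u , v)) (λ u v → ℕ.*-comm (w u) (w v))

  2#neither : 2 ℕ.* #neither ≡ ordered w̄ w̄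
  2#neither = edges-double (λ u v → neither (u , v)) (λ u v → ℕ.*-comm (w̄ u) (w̄ v))

  #mixed-ordered : #mixed ≡ ordered w w̄
  #mixed-ordered = ℕ.*-cancelˡ-≡ _ _ 2 (begin
    2 ℕ.* #mixed
      ≡⟨ edges-double (λ u v → mixed (u , v)) (λ u v → exchange (w u) (w̄ v) (w̄ u) (w v)) ⟩
    ∑[ u < n ] ∑[ v < n ] (adj u v ℕ.* mixed (u , v))
      ≡⟨ ∑∑-cong {n} {n} (λ u v → ℕ.*-distribˡ-+ (adj u v) (w u ℕ.* w̄ v) (w̄ u ℕ.* w v)) ⟩
    ∑[ u < n ] ∑[ v < n ] (adj u v ℕ.* (w u ℕ.* w̄ v) ℕ.+ adj u v ℕ.* (w̄ u ℕ.* w v))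
      ≡⟨ ∑∑-distrib-+ {n} {n} (λ u v → adj u v ℕ.* (w u ℕ.* w̄ v)) (λ u v → adj u v ℕ.* (w̄ u ℕ.* w v)) ⟩
    ordered w w̄ ℕ.+ ordered w̄ w
      ≡⟨ cong (ordered w w̄ ℕ.+_) (trans (ordered-comm w̄ w) (sym (ℕ.+-identityʳ _))) ⟩
    2 ℕ.* ordered w w̄ ∎)
    where
    open ≡-Reasoning
    exchange : ∀ a b c d → a ℕ.* b ℕ.+ c ℕ.* d ≡ d ℕ.* c ℕ.+ b ℕ.* a
    exchange = solve-∀

  #both-equation : 2 ℕ.* #both ℕ.+ #mixed ℕ.+ z ≡ z ℕ.* z
  #both-equation = trans (cong (ℕ._+ z) (trans (cong₂ ℕ._+_ 2#both #mixed-ordered) (ordered-degree w))) ∑-w-degree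

  #neither-equation : #mixed ℕ.+ 2 ℕ.* #neither ≡ z̄ ℕ.* z
  #neither-equation = trans (cong₂ ℕ._+_ (trans #mixed-ordered (ordered-comm w w̄)) 2#neither)
    (trans (ordered-degree w̄) ∑-w̄-degree)

-- Degrees and mixed edges of the total graph

module TotalGraph {p q : ℕ} (p-prime : Prime p) (q-prime : Prime q) (p≢q : p ≢ q)
  (2∤p : ¬ (2 ∣ p)) (2∤q : ¬ (2 ∣ q)) where

  open P²Q p-prime q-prime p≢q public

  private instance
    n≢0 : ℕ.NonZero n
    n≢0 = p²q-nonZero p-prime q-prime
    p≢0 : ℕ.NonZero p
    p≢0 = prime⇒nonZero p-prime
    q≢0 : ℕ.NonZero q
    q≢0 = prime⇒nonZero q-prime
    pq≢0 : ℕ.NonZero (p ℕ.* q)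
    pq≢0 = ℕ.m*n≢0 p q
    pp≢0 : ℕ.NonZero (p ℕ.* p)
    pp≢0 = ℕ.m*n≢0 p p
    p>1 : ℕ.NonTrivial p
    p>1 = prime⇒nonTrivial p-prime
    q>1 : ℕ.NonTrivial q
    q>1 = prime⇒nonTrivial q-prime

  open ℤmod n
  open ZeroDivisors n

  G : SimpleGraph n
  G = TΓ (ℤ/ n)

  open SimpleGraph G
  open EdgeSums G

  -- A residue coprime to n can be cancelled: n ∣ x · y would force n ∣ y, against y ≢ 0.
  zeroDivisor⇒shares : ∀ x → IsZeroDivisor ring x → Shares (toℕ x)
  zeroDivisor⇒shares x (inj₁ x≡0) = inj₁ (subst (p ∣_) (sym (trans (cong toℕ x≡0) toℕ[0])) (p ∣0))
  zeroDivisor⇒shares x (inj₂ (y , y≢0 , x⊗y≡0)) with shares? (toℕ x)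
  ... | yes s = s
  ... | no ¬s = contradiction (trans (sym ([]-toℕ y)) (∣⇒[]≡0 n∣y)) y≢0
    where
    n∣y : n ∣ toℕ y
    n∣y = coprime-divisor (coprime-sym (¬shares⇒coprime ¬s)) ([]≡0⇒∣ x⊗y≡0)

  shares⇒zeroDivisor : ∀ x → Shares (toℕ x) → IsZeroDivisor ring x
  shares⇒zeroDivisor x (inj₁ p∣x) = divisor⇒zeroDivisor n-as-p x p∣x
  shares⇒zeroDivisor x (inj₂ q∣x) = divisor⇒zeroDivisor n-as-q x q∣x

  w w̄ : Fin n → ℕ
  w x = 𝟙 (shares? (toℕ x))
  w̄ x = 𝟙 (¬? (shares? (toℕ x)))

  -- Since p and q divide n, reduction modulo n does not affect divisibility by them. This leads to
  -- integer sums, for which `shares-+` is stated.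
  w-⊕ : ∀ u v → w (u ⊕ v) ≡ 𝟙 (shares? (toℕ u ℕ.+ toℕ v))
  w-⊕ u v = 𝟙-cong (shares? (toℕ (u ⊕ v))) (shares? (toℕ u ℕ.+ toℕ v))
    (Sum.map (∣-[]⁻ (toℕ u ℕ.+ toℕ v) p∣n) (∣-[]⁻ (toℕ u ℕ.+ toℕ v) q∣n))
    (Sum.map (∣-[]⁺ (toℕ u ℕ.+ toℕ v) p∣n) (∣-[]⁺ (toℕ u ℕ.+ toℕ v) q∣n))

  odd-prime-∣-double : ∀ {r} → Prime r → ¬ (2 ∣ r) → ∀ k → r ∣ k ℕ.+ k → r ∣ k
  odd-prime-∣-double {r} r-prime 2∤r k r∣k+k
    with euclidsLemma 2 k r-prime (subst (λ m → r ∣ k ℕ.+ m) (sym (ℕ.+-identityʳ k)) r∣k+k)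
  ... | inj₂ r∣k = r∣k
  ... | inj₁ r∣2 with prime⇒irreducible prime[2] r∣2
  ...   | inj₁ r≡1 = contradiction r≡1 (prime≢1 r-prime)
  ...   | inj₂ refl = contradiction ∣-refl 2∤r

  w-double : ∀ u → w (u ⊕ u) ≡ w u
  w-double u = trans (w-⊕ u u) (𝟙-cong (shares? (toℕ u ℕ.+ toℕ u)) (shares? (toℕ u))
    (Sum.map (odd-prime-∣-double p-prime 2∤p (toℕ u)) (odd-prime-∣-double q-prime 2∤q (toℕ u)))
    (Sum.map (λ d → ∣m∣n⇒∣m+n d d) (λ d → ∣m∣n⇒∣m+n d d)))

  adj-value : ∀ u v → adj u v ≡ 𝟙 (¬? (u Fin.≟ v)) ℕ.* w (u ⊕ v)
  adj-value u v = trans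
    (𝟙-cong (adj? u v) (¬? (u Fin.≟ v) ×-dec shares? (toℕ (u ⊕ v)))
      (λ (u≢v , d) → u≢v , zeroDivisor⇒shares (u ⊕ v) d)
      (λ (u≢v , s) → u≢v , shares⇒zeroDivisor (u ⊕ v) s))
    (𝟙-× (¬? (u Fin.≟ v)) (shares? (toℕ (u ⊕ v))))

  -- The summand `w u` accounts for v = u: it is one of the z solutions of u + v ∈ S exactly when 2u
  -- ∈ S, and it is never a neighbour of u.
  degree+w : ∀ u → degree u ℕ.+ w u ≡ z
  degree+w u = begin
    degree u ℕ.+ w u
      ≡⟨ cong₂ ℕ._+_ (degree-sum u) (trans (sym (w-double u)) (sym (∑-≟ (λ v → w (u ⊕ v)) u))) ⟩
    ∑[ v < n ] adj u v ℕ.+ ∑[ v < n ] (𝟙 (u Fin.≟ v) ℕ.* w (u ⊕ v))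
      ≡⟨ ∑-distrib-+ {n} (adj u) (λ v → 𝟙 (u Fin.≟ v) ℕ.* w (u ⊕ v)) ⟨
    ∑[ v < n ] (adj u v ℕ.+ 𝟙 (u Fin.≟ v) ℕ.* w (u ⊕ v))
      ≡⟨ sum-cong-≗ {n} step ⟩
    ∑[ v < n ] w (u ⊕ v)
      ≡⟨ ∑-translate w u ⟩
    z ∎
    where
    open ≡-Reasoning
    step : ∀ v → adj u v ℕ.+ 𝟙 (u Fin.≟ v) ℕ.* w (u ⊕ v) ≡ w (u ⊕ v)
    step v = begin
      adj u v ℕ.+ 𝟙 (u Fin.≟ v) ℕ.* w (u ⊕ v)
        ≡⟨ cong (ℕ._+ 𝟙 (u Fin.≟ v) ℕ.* w (u ⊕ v)) (adj-value u v) ⟩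
      𝟙 (¬? (u Fin.≟ v)) ℕ.* w (u ⊕ v) ℕ.+ 𝟙 (u Fin.≟ v) ℕ.* w (u ⊕ v)
        ≡⟨ ℕ.*-distribʳ-+ (w (u ⊕ v)) (𝟙 (¬? (u Fin.≟ v))) (𝟙 (u Fin.≟ v)) ⟨
      (𝟙 (¬? (u Fin.≟ v)) ℕ.+ 𝟙 (u Fin.≟ v)) ℕ.* w (u ⊕ v)
        ≡⟨ cong (ℕ._* w (u ⊕ v)) (trans (ℕ.+-comm _ (𝟙 (u Fin.≟ v))) (𝟙-¬ (u Fin.≟ v))) ⟩
      1 ℕ.* w (u ⊕ v)
        ≡⟨ ℕ.*-identityˡ (w (u ⊕ v)) ⟩
      w (u ⊕ v) ∎

  module Classes = TwoClasses G (λ u → shares? (toℕ u)) z degree+w refl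
  open Classes using (ordered; w+w̄; w*w̄)

  -- Adding the number of v with both v and u ⊕ v in S, the left side counts the v
  -- with u ⊕ v in S and the right side the v in S; both counts are z.
  boundary : ∀ u → ∑[ v < n ] (w (u ⊕ v) ℕ.* w̄ v) ≡ ∑[ v < n ] (w v ℕ.* w̄ (u ⊕ v))
  boundary u = ℕ.+-cancelˡ-≡ (∑[ v < n ] (w (u ⊕ v) ℕ.* w v)) _ _ (begin
    ∑[ v < n ] (w (u ⊕ v) ℕ.* w v) ℕ.+ ∑[ v < n ] (w (u ⊕ v) ℕ.* w̄ v)
      ≡⟨ merge (λ v → w (u ⊕ v)) w w̄ w+w̄ ⟩
    ∑[ v < n ] w (u ⊕ v)
      ≡⟨ ∑-translate w u ⟩
    z
      ≡⟨ merge w (λ v → w (u ⊕ v)) (λ v → w̄ (u ⊕ v)) (λ v → w+w̄ (u ⊕ v)) ⟨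
    ∑[ v < n ] (w v ℕ.* w (u ⊕ v)) ℕ.+ ∑[ v < n ] (w v ℕ.* w̄ (u ⊕ v))
      ≡⟨ cong (ℕ._+ ∑[ v < n ] (w v ℕ.* w̄ (u ⊕ v))) (sum-cong-≗ {n} (λ v → ℕ.*-comm (w v) (w (u ⊕ v)))) ⟩
    ∑[ v < n ] (w (u ⊕ v) ℕ.* w v) ℕ.+ ∑[ v < n ] (w v ℕ.* w̄ (u ⊕ v)) ∎)
    where
    open ≡-Reasoning
    merge : ∀ (f g h : Fin n → ℕ) → (∀ v → g v ℕ.+ h v ≡ 1) →
      ∑[ v < n ] (f v ℕ.* g v) ℕ.+ ∑[ v < n ] (f v ℕ.* h v) ≡ ∑[ v < n ] f v
    merge f g h g+h = trans (sym (∑-distrib-+ {n} (λ v → f v ℕ.* g v) (λ v → f v ℕ.* h v)))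
      (sum-cong-≗ {n} (λ v → trans (sym (ℕ.*-distribˡ-+ (f v) (g v) (h v)))
        (trans (cong (f v ℕ.*_) (g+h v)) (ℕ.*-identityʳ (f v)))))

  #P #Q : ℕ
  #P = ∑[ i < n ] onlyP (toℕ i)
  #Q = ∑[ i < n ] onlyQ (toℕ i)

  -- The origin of β: the residue divisible by p only may come first or second, so the product of
  -- p(q - 1) and p(p - 1) occurs twice.
  ordered-w-w̄ : ordered w w̄ ≡ #P ℕ.* #Q ℕ.+ #Q ℕ.* #P
  ordered-w-w̄ = begin
    ordered w w̄
      ≡⟨ ∑∑-cong {n} {n} off-diagonal ⟩
    ∑[ u < n ] ∑[ v < n ] (w u ℕ.* (w (u ⊕ v) ℕ.* w̄ v))
      ≡⟨ sum-cong-≗ {n} (λ u → sym (*-distribˡ-sum {n} (w u) (λ v → w (u ⊕ v) ℕ.* w̄ v))) ⟩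
    ∑[ u < n ] (w u ℕ.* ∑[ v < n ] (w (u ⊕ v) ℕ.* w̄ v))
      ≡⟨ sum-cong-≗ {n} (λ u → cong (w u ℕ.*_) (boundary u)) ⟩
    ∑[ u < n ] (w u ℕ.* ∑[ v < n ] (w v ℕ.* w̄ (u ⊕ v)))
      ≡⟨ sum-cong-≗ {n} (λ u → *-distribˡ-sum {n} (w u) (λ v → w v ℕ.* w̄ (u ⊕ v))) ⟩
    ∑[ u < n ] ∑[ v < n ] (w u ℕ.* (w v ℕ.* w̄ (u ⊕ v)))
      ≡⟨ ∑∑-cong {n} {n} (λ u v → trans (sym (ℕ.*-assoc (w u) (w v) (w̄ (u ⊕ v))))
           (trans (cong (w u ℕ.* w v ℕ.*_) (w̄-⊕ u v)) (shares-+ (toℕ u) (toℕ v)))) ⟩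
    ∑[ u < n ] ∑[ v < n ] (onlyP (toℕ u) ℕ.* onlyQ (toℕ v) ℕ.+ onlyQ (toℕ u) ℕ.* onlyP (toℕ v))
      ≡⟨ ∑∑-distrib-+ {n} {n} (λ u v → onlyP (toℕ u) ℕ.* onlyQ (toℕ v)) (λ u v → onlyQ (toℕ u) ℕ.* onlyP (toℕ v)) ⟩
    ∑[ u < n ] ∑[ v < n ] (onlyP (toℕ u) ℕ.* onlyQ (toℕ v)) ℕ.+ ∑[ u < n ] ∑[ v < n ] (onlyQ (toℕ u) ℕ.* onlyP (toℕ v))
      ≡⟨ cong₂ ℕ._+_ (sum-*-sum {n} {n} (onlyP ∘ toℕ) (onlyQ ∘ toℕ)) (sum-*-sum {n} {n} (onlyQ ∘ toℕ) (onlyP ∘ toℕ)) ⟩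
    #P ℕ.* #Q ℕ.+ #Q ℕ.* #P ∎
    where
    open ≡-Reasoning
    w̄-⊕ : ∀ u v → w̄ (u ⊕ v) ≡ 𝟙 (¬? (shares? (toℕ u ℕ.+ toℕ v)))
    w̄-⊕ u v = ℕ.+-cancelˡ-≡ (w (u ⊕ v)) _ _ (trans (w+w̄ (u ⊕ v))
      (sym (trans (cong (ℕ._+ 𝟙 (¬? (shares? (toℕ u ℕ.+ toℕ v)))) (w-⊕ u v)) (𝟙-¬ (shares? (toℕ u ℕ.+ toℕ v))))))
    regroup : ∀ s x y → 1 ℕ.* s ℕ.* (x ℕ.* y) ≡ x ℕ.* (s ℕ.* y)
    regroup = solve-∀
    off-diagonal′ : ∀ u v → Dec (u ≡ v) → adj u v ℕ.* (w u ℕ.* w̄ v) ≡ w u ℕ.* (w (u ⊕ v) ℕ.* w̄ v)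
    off-diagonal′ u _ (yes refl) = trans (trans (cong (adj u u ℕ.*_) (w*w̄ u)) (ℕ.*-zeroʳ (adj u u))) (sym (begin
            w u ℕ.* (w (u ⊕ u) ℕ.* w̄ u) ≡⟨ cong (λ t → w u ℕ.* (t ℕ.* w̄ u)) (w-double u) ⟩
            w u ℕ.* (w u ℕ.* w̄ u)       ≡⟨ cong (w u ℕ.*_) (w*w̄ u) ⟩
            w u ℕ.* 0                    ≡⟨ ℕ.*-zeroʳ (w u) ⟩
            0                       ∎))
    off-diagonal′ u v (no u≢v) = trans
            (cong (ℕ._* (w u ℕ.* w̄ v)) (trans (adj-value u v) (cong (ℕ._* w (u ⊕ v)) (𝟙-yes (¬? (u Fin.≟ v)) u≢v))))
            (regroup (w (u ⊕ v)) (w u) (w̄ v))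
    off-diagonal : ∀ u v → adj u v ℕ.* (w u ℕ.* w̄ v) ≡ w u ℕ.* (w (u ⊕ v) ℕ.* w̄ v)
    off-diagonal u v = off-diagonal′ u v (u Fin.≟ v)

  -- Makes z - 1 positive, as `hypot-diagonal` requires of its scale factor.
  2≤z : 2 ℕ.≤ z
  2≤z = ℕ.+-cancelʳ-≤ p 2 z (begin
    2 ℕ.+ p             ≤⟨ ℕ.+-mono-≤ (ℕ.nonTrivial⇒n>1 p) (ℕ.m≤m*n p q) ⟩
    p ℕ.+ p ℕ.* q       ≤⟨ ℕ.+-monoˡ-≤ (p ℕ.* q) (ℕ.m≤m*n p p) ⟩
    p ℕ.* p ℕ.+ p ℕ.* q ≡⟨ ℕ.+-comm (p ℕ.* p) (p ℕ.* q) ⟩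
    p ℕ.* q ℕ.+ p ℕ.* p ≡⟨ z-value ⟨
    z ℕ.+ p             ∎)
    where open ℕ.≤-Reasoning

-- Real numbers

-- Opaque so that the type checker never unfolds the gcd computation inside ℚ._/_.
opaque
  ι : ℕ → ℚ
  ι n = + n ℚ./ 1

  seq-fromℕ : ∀ n m → seq (fromℕ n) m ≡ ι n
  seq-fromℕ n m = refl

  ι-0 : ι 0 ≡ 0ℚ
  ι-0 = refl

  ι-1 : ι 1 ≡ 1ℚ
  ι-1 = refl

  ι-+ : ∀ m n → ι (m ℕ.+ n) ≡ ι m ℚ.+ ι n
  ι-+ m n = ℚ.toℚᵘ-injective (ℚᵘ.≃-trans (frac-toℚᵘ (m ℕ.+ n) 0) (ℚᵘ.≃-sym
    (ℚᵘ.≃-trans (ℚ.toℚᵘ-homo-+ (ι m) (ι n)) (ℚᵘ.≃-trans (ℚᵘ.+-cong (frac-toℚᵘ m 0) (frac-toℚᵘ n 0))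
      (ℚᵘ.*≡* (identity (+ m) (+ n)))))))
    where
    identity : ∀ a b → (a ℤ.* + 1 ℤ.+ b ℤ.* + 1) ℤ.* + 1 ≡ (a ℤ.+ b) ℤ.* + 1
    identity = ℤ-solve

  ι-* : ∀ m n → ι (m ℕ.* n) ≡ ι m ℚ.* ι n
  ι-* m n = ℚ.toℚᵘ-injective (ℚᵘ.≃-trans (frac-toℚᵘ (m ℕ.* n) 0) (ℚᵘ.≃-sym
    (ℚᵘ.≃-trans (ℚ.toℚᵘ-homo-* (ι m) (ι n)) (ℚᵘ.≃-trans (ℚᵘ.*-cong (frac-toℚᵘ m 0) (frac-toℚᵘ n 0))
      (ℚᵘ.*≡* (cong (ℤ._* + 1) (sym (ℤ.pos-* m n))))))))

  ι-pos : ∀ n .{{_ : ℕ.NonZero n}} → 0ℚ ℚ.< ι n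
  ι-pos (suc n) = ℚ.positive⁻¹ (ι (suc n)) {{ℚ.normalize-pos (suc n) 1}}

ι-2 : ι 2 ≡ 1ℚ ℚ.+ 1ℚ
ι-2 = trans (ι-+ 1 1) (cong₂ ℚ._+_ ι-1 ι-1)

ι-^2 : ∀ n → ι (n ℕ.^ 2) ≡ sq (ι n)
ι-^2 n = trans (cong (λ m → ι (n ℕ.* m)) (ℕ.*-identityʳ n)) (ι-* n n)

pointwise : ∀ {x y} → (∀ n → seq x n ≡ seq y n) → x ≃ y
pointwise {x} {y} eq = mk≃ λ ε 0<ε → 0 , λ n _ →
  subst (λ t → ℚ.∣ seq x n ℚ.- t ∣ ℚ.< ε) (eq n) (self-close (seq x n) 0<ε)

≃-trans : ∀ {x y z} → x ≃ y → y ≃ z → x ≃ z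
≃-trans {x} {y} {z} (mk≃ x≃y) (mk≃ y≃z) = mk≃ λ ε 0<ε →
  let N₁ , c₁ = x≃y (½ ℚ.* ε) (half-pos 0<ε)
      N₂ , c₂ = y≃z (½ ℚ.* ε) (half-pos 0<ε)
  in N₁ ℕ.⊔ N₂ , λ n N≤n → subst (λ t → ℚ.∣ t ∣ ℚ.< ε)
    (solve 3 (λ a b c → (a :+ b) :- (b :+ c) := a :- c) refl (seq x n) (seq y n) (seq z n))
    (+-close (seq x n) (seq y n) (seq y n) (seq z n)
      (c₁ n (ℕ.m⊔n≤o⇒m≤o N₁ N₂ N≤n)) (c₂ n (ℕ.m⊔n≤o⇒n≤o N₁ N₂ N≤n)))
  where open +-*-Solver

+-cong : ∀ {x x′ y y′} → x ≃ x′ → y ≃ y′ → x + y ≃ x′ + y′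
+-cong {x} {x′} {y} {y′} (mk≃ x≃x′) (mk≃ y≃y′) = mk≃ λ ε 0<ε →
  let N₁ , c₁ = x≃x′ (½ ℚ.* ε) (half-pos 0<ε)
      N₂ , c₂ = y≃y′ (½ ℚ.* ε) (half-pos 0<ε)
  in N₁ ℕ.⊔ N₂ , λ n N≤n → +-close (seq x n) (seq x′ n) (seq y n) (seq y′ n)
    (c₁ n (ℕ.m⊔n≤o⇒m≤o N₁ N₂ N≤n)) (c₂ n (ℕ.m⊔n≤o⇒n≤o N₁ N₂ N≤n))

*-congˡ : ∀ κ c {x y} → (∀ n → seq κ n ≡ c) → x ≃ y → κ * x ≃ κ * y
*-congˡ κ c {x} {y} κ≡c (mk≃ x≃y) = mk≃ λ ε 0<ε →
  -- The added 1 keeps the bound positive when c = 0 and makes the estimate of c strict.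
  let B = ℚ.∣ c ∣ ℚ.+ 1ℚ
      0<B = ℚ.+-mono-≤-< (ℚ.0≤∣p∣ c) (ℚ.positive⁻¹ 1ℚ)
      c<B = subst (ℚ._< B) (ℚ.+-identityʳ ℚ.∣ c ∣) (ℚ.+-monoʳ-< ℚ.∣ c ∣ (ℚ.positive⁻¹ 1ℚ))
      δ , 0<δ , B*δ≡ε = scale 0<B 0<ε
      N , close = x≃y δ 0<δ
  in N , λ n N≤n → subst₂ (λ s t → ℚ.∣ s ∣ ℚ.< t)
    (trans (solve 3 (λ c a b → c :* (a :- b) := c :* a :- c :* b) refl c (seq x n) (seq y n))
      (cong (λ k → k ℚ.* seq x n ℚ.- k ℚ.* seq y n) (sym (κ≡c n)))) B*δ≡ε
    (*-abs-< c<B 0<B (close n N≤n))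
  where open +-*-Solver

-- Scaling of square roots

sq-* : ∀ a b → sq (a ℚ.* b) ≡ sq a ℚ.* sq b
sq-* = solve 2 (λ a b → (a :* b) :* (a :* b) := (a :* a) :* (b :* b)) refl
  where open +-*-Solver

-- The n-th terms differ in general, but both have a square at most u or are 0, and both exceed √u
-- in the square once increased by their slack, 1/(n + 1) on the left and k/(n + 1) on the right.
-- `root-close`, applied in both directions with equal radicands, bounds the difference.
√-scale-constant : ∀ {k t u} → 0ℚ ℚ.< k → u ≡ sq k ℚ.* t → √ (fromℚ u) ≃ fromℚ k * √ (fromℚ t)
√-scale-constant {k} {t} {u} 0<k u≡k²t = mk≃ λ ε 0<ε →
  -- `root-close` gives an error of e + e. The choice of δ brings the slack k/(n + 1) below e.
  let e = ½ ℚ.* ε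
      0<e = half-pos 0<ε
      δ , 0<δ , k*δ≡e = scale 0<k 0<e
      N₁ , small-δ = frac-small 0<δ
      N₂ , small-e = frac-small 0<e
  in N₁ ℕ.⊔ N₂ , λ n N≤n → ∣-∣-<
    (subst (λ η → root u n ℚ.< k ℚ.* root t n ℚ.+ η) (half+half ε)
      (below n 0<e k*δ≡e (small-δ n (ℕ.m⊔n≤o⇒m≤o N₁ N₂ N≤n))))
    (subst (λ η → k ℚ.* root t n ℚ.< root u n ℚ.+ η) (half+half ε)
      (above n 0<e (small-e n (ℕ.m⊔n≤o⇒n≤o N₁ N₂ N≤n))))
  where
  0≤k : 0ℚ ℚ.≤ k
  0≤k = ℚ.<⇒≤ 0<k
  0<k² : 0ℚ ℚ.< sq k
  0<k² = pos*pos 0<k 0<k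
  scale-≤ : ∀ {a b} → a ℚ.≤ b → k ℚ.* a ℚ.≤ k ℚ.* b
  scale-≤ = ℚ.*-monoˡ-≤-nonNeg k {{ℚ.nonNegative 0≤k}}
  scale-nonNeg : ∀ {a} → 0ℚ ℚ.≤ a → 0ℚ ℚ.≤ k ℚ.* a
  scale-nonNeg {a} 0≤a = subst (ℚ._≤ k ℚ.* a) (ℚ.*-zeroʳ k) (scale-≤ 0≤a)
  no-gap : ∀ {e} → 0ℚ ℚ.< e → u ℚ.- u ℚ.< sq e
  no-gap {e} 0<e = subst (ℚ._< sq e) (sym (ℚ.+-inverseʳ u)) (pos*pos 0<e 0<e)
  scaled-sound : ∀ n → k ℚ.* root t n ≡ 0ℚ ⊎ sq (k ℚ.* root t n) ℚ.≤ u
  scaled-sound n = Sum.map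
    (λ s≡0 → trans (cong (k ℚ.*_) s≡0) (ℚ.*-zeroʳ k))
    (λ s²≤t → subst₂ ℚ._≤_ (sym (sq-* k (root t n))) (sym u≡k²t)
      (ℚ.*-monoˡ-≤-nonNeg (sq k) {{ℚ.nonNegative (ℚ.<⇒≤ 0<k²)}} s²≤t))
    (root-sound t n)
  scaled-maximal : ∀ n → u ℚ.< sq (k ℚ.* root t n ℚ.+ k ℚ.* frac 1 n)
  scaled-maximal n = subst₂ ℚ._<_ (sym u≡k²t)
    (trans (sym (sq-* k (root t n ℚ.+ frac 1 n))) (cong sq (ℚ.*-distribˡ-+ k (root t n) (frac 1 n))))
    (ℚ.*-monoʳ-<-pos (sq k) {{ℚ.positive 0<k²}} (root-maximal t n))
  below : ∀ n {e δ} → 0ℚ ℚ.< e → k ℚ.* δ ≡ e → frac 1 n ℚ.≤ δ → root u n ℚ.< k ℚ.* root t n ℚ.+ (e ℚ.+ e)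
  below n 0<e k*δ≡e w≤δ = root-close 0<e (scale-nonNeg (root-nonNeg t n)) (scale-nonNeg (frac-nonNeg 1 n))
    (subst (k ℚ.* frac 1 n ℚ.≤_) k*δ≡e (scale-≤ w≤δ)) (root-sound u n) (scaled-maximal n) (no-gap 0<e)
  above : ∀ n {e} → 0ℚ ℚ.< e → frac 1 n ℚ.≤ e → k ℚ.* root t n ℚ.< root u n ℚ.+ (e ℚ.+ e)
  above n 0<e w≤e = root-close 0<e (root-nonNeg u n) (frac-nonNeg 1 n) w≤e
    (scaled-sound n) (root-maximal u n) (no-gap 0<e)

√-cong : ∀ x y → (∀ n → seq x n ≡ seq y n) → √ x ≃ √ y
√-cong x y eq = pointwise {√ x} {√ y} λ n → cong (λ t → root t n) (eq n)

-- Stated through the terms of the sequences so that `ι` can remain opaque: where it is not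
-- unfolded, the terms of `fromℕ k` equal `ι k` only propositionally.
√-scale : ∀ x y k {r t} → (∀ n → seq x n ≡ sq r ℚ.* t) → (∀ n → seq y n ≡ t) → (∀ n → seq k n ≡ r) →
  0ℚ ℚ.< r → √ x ≃ k * √ y
√-scale x y k {r} {t} x-eq y-eq k-eq 0<r = ≃-trans {√ x} {√ (fromℚ (sq r ℚ.* t))} {k * √ y}
  (√-cong x (fromℚ (sq r ℚ.* t)) x-eq)
  (≃-trans {√ (fromℚ (sq r ℚ.* t))} {fromℚ r * √ (fromℚ t)} {k * √ y}
    (√-scale-constant {r} {t} 0<r refl)
    (pointwise {fromℚ r * √ (fromℚ t)} {k * √ y} λ n →
      sym (cong₂ (λ a t → a ℚ.* root t n) (k-eq n) (y-eq n))))

opaque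
  -- Opaque for the same reason.
  hypot : ℕ → ℕ → ℝ
  hypot d e = √ (fromℕ (d ℕ.^ 2 ℕ.+ e ℕ.^ 2))

  seq-hypot : ∀ d e n → seq (hypot d e) n ≡ root (ι (d ℕ.^ 2 ℕ.+ e ℕ.^ 2)) n
  seq-hypot d e n = cong (λ t → root t n) {seq (fromℕ (d ℕ.^ 2 ℕ.+ e ℕ.^ 2)) n} {ι (d ℕ.^ 2 ℕ.+ e ℕ.^ 2)}
    (seq-fromℕ (d ℕ.^ 2 ℕ.+ e ℕ.^ 2) n)

  hypot-diagonal : ∀ k .{{_ : ℕ.NonZero k}} → hypot k k ≃ fromℕ k * √ (fromℕ 2)
  hypot-diagonal k = √-scale (fromℕ (k ℕ.^ 2 ℕ.+ k ℕ.^ 2)) (fromℕ 2) (fromℕ k)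
    (λ n → trans (seq-fromℕ (k ℕ.^ 2 ℕ.+ k ℕ.^ 2) n) double)
    (seq-fromℕ 2) (seq-fromℕ k) (ι-pos k)
    where
    double : ι (k ℕ.^ 2 ℕ.+ k ℕ.^ 2) ≡ sq (ι k) ℚ.* ι 2
    double = trans (cong ι (trans (cong (k ℕ.^ 2 ℕ.+_) (sym (ℕ.+-identityʳ (k ℕ.^ 2)))) (ℕ.*-comm 2 (k ℕ.^ 2))))
      (trans (ι-* (k ℕ.^ 2) 2) (cong (ℚ._* ι 2) (ι-^2 k)))

module _ {n : ℕ} (G : SimpleGraph n) where
  open SimpleGraph G

  -- The summands must be found by unification: comparing them with a copy
  -- written out here would unfold the square roots.
  SO-terms : ∃[ x ] SO G ≡ sumℝ (map x edges)
  SO-terms = _ , refl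

  opaque
    unfolding ι

    SO-terms-root : ∀ u v m → seq (proj₁ SO-terms (u , v)) m ≡ root (ι (degree u ℕ.^ 2 ℕ.+ degree v ℕ.^ 2)) m
    SO-terms-root u v m = refl

  SO-terms-hypot : ∀ u v m → seq (proj₁ SO-terms (u , v)) m ≡ seq (hypot (degree u) (degree v)) m
  SO-terms-hypot u v m = trans (SO-terms-root u v m) (sym (seq-hypot (degree u) (degree v) m))

hypot-comm : ∀ d e n → seq (hypot d e) n ≡ seq (hypot e d) n
hypot-comm d e n = trans (seq-hypot d e n)
  (trans (cong (λ k → root (ι k) n) (ℕ.+-comm (d ℕ.^ 2) (e ℕ.^ 2))) (sym (seq-hypot e d n)))

-- Linear combinations of the three kinds of edge terms

combine : (a b c f g h : ℚ) → ℚ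
combine a b c f g h = f ℚ.* a ℚ.+ g ℚ.* b ℚ.+ h ℚ.* c

combine-0 : ∀ a b c → 0ℚ ≡ combine a b c 0ℚ 0ℚ 0ℚ
combine-0 = solve 3 (λ a b c → con 0ℚ := con 0ℚ :* a :+ con 0ℚ :* b :+ con 0ℚ :* c) refl
  where open +-*-Solver

combine-1 : ∀ a b c → (combine a b c 1ℚ 0ℚ 0ℚ ≡ a) × (combine a b c 0ℚ 1ℚ 0ℚ ≡ b) × (combine a b c 0ℚ 0ℚ 1ℚ ≡ c)
combine-1 a b c =
    solve 3 (λ a b c → con 1ℚ :* a :+ con 0ℚ :* b :+ con 0ℚ :* c := a) refl a b c
  , solve 3 (λ a b c → con 0ℚ :* a :+ con 1ℚ :* b :+ con 0ℚ :* c := b) refl a b c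
  , solve 3 (λ a b c → con 0ℚ :* a :+ con 0ℚ :* b :+ con 1ℚ :* c := c) refl a b c
  where open +-*-Solver

combine-+ : ∀ a b c f g h f′ g′ h′ →
  combine a b c f g h ℚ.+ combine a b c f′ g′ h′ ≡ combine a b c (f ℚ.+ f′) (g ℚ.+ g′) (h ℚ.+ h′)
combine-+ a b c f g h f′ g′ h′ = trans
  (interchange (f ℚ.* a) (g ℚ.* b) (h ℚ.* c) (f′ ℚ.* a) (g′ ℚ.* b) (h′ ℚ.* c))
  (sym (cong₂ ℚ._+_ (cong₂ ℚ._+_ (ℚ.*-distribʳ-+ a f f′) (ℚ.*-distribʳ-+ b g g′)) (ℚ.*-distribʳ-+ c h h′)))
  where
  open +-*-Solver
  interchange : ∀ x y z x′ y′ z′ → (x ℚ.+ y ℚ.+ z) ℚ.+ (x′ ℚ.+ y′ ℚ.+ z′) ≡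
    (x ℚ.+ x′) ℚ.+ (y ℚ.+ y′) ℚ.+ (z ℚ.+ z′)
  interchange = solve 6 (λ x y z x′ y′ z′ → (x :+ y :+ z) :+ (x′ :+ y′ :+ z′) := (x :+ x′) :+ (y :+ y′) :+ (z :+ z′)) refl

-- With the index n fixed this is a statement about rationals, so no convergence is involved.
-- `combine` is linear in its last three arguments, hence the multiplicities add up along the list.
sumℝ-classes : ∀ {X : Set} (x : X → ℝ) (f g h : X → ℕ) (n : ℕ) (a b c : ℚ) →
  (∀ i → seq (x i) n ≡ combine a b c (ι (f i)) (ι (g i)) (ι (h i))) →
  ∀ xs → seq (sumℝ (map x xs)) n ≡ combine a b c (ι (sumBy f xs)) (ι (sumBy g xs)) (ι (sumBy h xs))
sumℝ-classes x f g h n a b c eq [] = trans (trans (seq-fromℕ 0 n) ι-0)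
  (trans (combine-0 a b c) (cong (λ t → combine a b c t t t) (sym ι-0)))
sumℝ-classes x f g h n a b c eq (i ∷ is) = trans
  (cong₂ ℚ._+_ (eq i) (sumℝ-classes x f g h n a b c eq is))
  (trans (combine-+ a b c (ι (f i)) (ι (g i)) (ι (h i)) (ι (sumBy f is)) (ι (sumBy g is)) (ι (sumBy h is)))
    (sym (cong₃-combine (ι-+ (f i) (sumBy f is)) (ι-+ (g i) (sumBy g is)) (ι-+ (h i) (sumBy h is)))))
  where
  cong₃-combine : ∀ {f g h f′ g′ h′} → f ≡ f′ → g ≡ g′ → h ≡ h′ → combine a b c f g h ≡ combine a b c f′ g′ h′
  cong₃-combine refl refl refl = refl

SO-classes : ∀ {n} (G : SimpleGraph n) (let open SimpleGraph G) (f g h : Fin n × Fin n → ℕ) m (a b c : ℚ) →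
  (∀ u v → seq (hypot (degree u) (degree v)) m ≡ combine a b c (ι (f (u , v))) (ι (g (u , v))) (ι (h (u , v)))) →
  seq (SO G) m ≡ combine a b c (ι (sumBy f edges)) (ι (sumBy g edges)) (ι (sumBy h edges))
SO-classes G f g h m a b c eq = trans (cong (λ x → seq x m) (proj₂ (SO-terms G)))
  (sumℝ-classes (proj₁ (SO-terms G)) f g h m a b c
    (λ (u , v) → trans (SO-terms-hypot G u v m) (eq u v)) (SimpleGraph.edges G))

-- o, h and t stand for 1, ½ and 2: the ring solver is fast only on identities
-- without rational constants.
module ClosedForm (o h t : ℚ) (o-one : ∀ x → x ℚ.* o ≡ x) (h-half : ∀ x → h ℚ.* x ℚ.+ h ℚ.* x ≡ x)
  (t-two : ∀ x → t ℚ.* x ≡ x ℚ.+ x) where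
  open +-*-Solver

  *-pred : ∀ x y → x ℚ.* (y ℚ.- o) ≡ x ℚ.* y ℚ.- x
  *-pred x y = trans (solve 3 (λ x y o → x :* (y :- o) := x :* y :- x :* o) refl x y o)
    (cong (λ w → x ℚ.* y ℚ.- w) (o-one x))

  isolate : ∀ a b c → a ℚ.+ b ≡ c → a ≡ c ℚ.- b
  isolate a b c eq = trans (solve 2 (λ a b → a := (a :+ b) :- b) refl a b) (cong (ℚ._- b) eq)

  halve : ∀ a c → t ℚ.* a ≡ c → a ≡ h ℚ.* c
  halve a c eq = sym (trans (cong (h ℚ.*_) (trans (sym eq) (t-two a)))
    (trans (ℚ.*-distribˡ-+ h a a) (h-half a)))

  module _ (P Q : ℚ) where

    X Y α β : ℚ
    X = P ℚ.* (Q ℚ.- o)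
    Y = P ℚ.* (P ℚ.- o)
    α = h ℚ.* (P ℚ.* (Q ℚ.- o) ℚ.* (P ℚ.* (Q ℚ.- o) ℚ.- o))
      ℚ.+ h ℚ.* (P ℚ.* (P ℚ.- o) ℚ.* (P ℚ.* (P ℚ.- o) ℚ.- o))
      ℚ.+ h ℚ.* (P ℚ.* (P ℚ.- o))
      ℚ.+ P ℚ.* P ℚ.* (Q ℚ.- o)
      ℚ.+ P ℚ.* P ℚ.* (P ℚ.- o)
    β = t ℚ.* (P ℚ.* P) ℚ.* (P ℚ.- o) ℚ.* (Q ℚ.- o)

    E : ℚ → ℚ
    E N = h ℚ.* (P ℚ.* (P ℚ.+ Q ℚ.- o) ℚ.* (N ℚ.- o))

    X-value : ∀ x → x ℚ.+ P ≡ P ℚ.* Q → x ≡ X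
    X-value x eq = trans (isolate x P (P ℚ.* Q) eq) (sym (*-pred P Q))

    Y-value : ∀ y → y ℚ.+ P ≡ P ℚ.* P → y ≡ Y
    Y-value y eq = trans (isolate y P (P ℚ.* P) eq) (sym (*-pred P P))

    Z-value : ∀ Z → Z ℚ.+ P ≡ P ℚ.* Q ℚ.+ P ℚ.* P → Z ≡ P ℚ.* (P ℚ.+ Q ℚ.- o)
    Z-value Z eq = trans (isolate Z P (P ℚ.* Q ℚ.+ P ℚ.* P) eq)
      (trans (solve 2 (λ P Q → P :* Q :+ P :* P :- P := P :* (P :+ Q) :- P) refl P Q) (sym (*-pred P (P ℚ.+ Q))))

    -- S is the disjoint union of the residues divisible by p only, by q only and by both, numbering
    -- X, Y and P.
    Z-split : ∀ Z → Z ℚ.+ P ≡ P ℚ.* Q ℚ.+ P ℚ.* P → Z ≡ X ℚ.+ Y ℚ.+ P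
    Z-split Z eq = trans (isolate Z P (P ℚ.* Q ℚ.+ P ℚ.* P) eq)
      (trans (solve 2 (λ P Q → P :* Q :+ P :* P :- P := (P :* Q :- P) :+ (P :* P :- P) :+ P) refl P Q)
        (sym (cong₂ (λ x y → x ℚ.+ y ℚ.+ P) (*-pred P Q) (*-pred P P))))

    β-value : ∀ x y → x ℚ.+ P ≡ P ℚ.* Q → y ℚ.+ P ≡ P ℚ.* P → x ℚ.* y ℚ.+ y ℚ.* x ≡ β
    β-value x y x-eq y-eq = begin
      x ℚ.* y ℚ.+ y ℚ.* x
        ≡⟨ cong₂ (λ x y → x ℚ.* y ℚ.+ y ℚ.* x) (X-value x x-eq) (Y-value y y-eq) ⟩
      X ℚ.* Y ℚ.+ Y ℚ.* X
        ≡⟨ solve 3 (λ P U V → P :* V :* (P :* U) :+ P :* U :* (P :* V) := (P :* P :+ P :* P) :* U :* V)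
             refl P (P ℚ.- o) (Q ℚ.- o) ⟩
      (P ℚ.* P ℚ.+ P ℚ.* P) ℚ.* (P ℚ.- o) ℚ.* (Q ℚ.- o)
        ≡⟨ cong (λ w → w ℚ.* (P ℚ.- o) ℚ.* (Q ℚ.- o)) (t-two (P ℚ.* P)) ⟨
      β ∎
      where open ≡-Reasoning

    -- Substituting Z = X + Y + P and b = 2XY into 2a = Z² - Z - b cancels the products XY. What is
    -- left counts the pairs inside each of the three parts of S, and the pairs joining the P
    -- multiples of both primes to the other two parts.
    α-value : ∀ Z a b → Z ℚ.+ P ≡ P ℚ.* Q ℚ.+ P ℚ.* P → b ≡ X ℚ.* Y ℚ.+ Y ℚ.* X →
      t ℚ.* a ℚ.+ b ℚ.+ Z ≡ Z ℚ.* Z → a ≡ α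
    α-value Z a b Z-eq b-eq a-eq = begin
      a
        ≡⟨ halve a (Z ℚ.* Z ℚ.- Z ℚ.- b) (isolate (t ℚ.* a) b (Z ℚ.* Z ℚ.- Z) (isolate (t ℚ.* a ℚ.+ b) Z (Z ℚ.* Z) a-eq)) ⟩
      h ℚ.* (Z ℚ.* Z ℚ.- Z ℚ.- b)
        ≡⟨ cong₂ (λ z b → h ℚ.* (z ℚ.* z ℚ.- z ℚ.- b)) (Z-split Z Z-eq) b-eq ⟩
      h ℚ.* ((X ℚ.+ Y ℚ.+ P) ℚ.* (X ℚ.+ Y ℚ.+ P) ℚ.- (X ℚ.+ Y ℚ.+ P) ℚ.- (X ℚ.* Y ℚ.+ Y ℚ.* X))
        ≡⟨ expand h X Y P ⟩
      h ℚ.* (X ℚ.* X ℚ.- X) ℚ.+ h ℚ.* (Y ℚ.* Y ℚ.- Y) ℚ.+ h ℚ.* (P ℚ.* P ℚ.- P)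
        ℚ.+ (h ℚ.* (P ℚ.* X) ℚ.+ h ℚ.* (P ℚ.* X)) ℚ.+ (h ℚ.* (P ℚ.* Y) ℚ.+ h ℚ.* (P ℚ.* Y))
        ≡⟨ cong₂ ℚ._+_ (cong₂ ℚ._+_ (cong₂ ℚ._+_ (cong₂ ℚ._+_
             (cong (h ℚ.*_) (sym (*-pred X X))) (cong (h ℚ.*_) (sym (*-pred Y Y)))) (cong (h ℚ.*_) (sym (*-pred P P))))
             (trans (h-half (P ℚ.* X)) (sym (ℚ.*-assoc P P (Q ℚ.- o)))))
             (trans (h-half (P ℚ.* Y)) (sym (ℚ.*-assoc P P (P ℚ.- o)))) ⟩
      α ∎
      where
      open ≡-Reasoning
      expand : ∀ h X Y P → h ℚ.* ((X ℚ.+ Y ℚ.+ P) ℚ.* (X ℚ.+ Y ℚ.+ P) ℚ.- (X ℚ.+ Y ℚ.+ P) ℚ.- (X ℚ.* Y ℚ.+ Y ℚ.* X)) ≡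
        h ℚ.* (X ℚ.* X ℚ.- X) ℚ.+ h ℚ.* (Y ℚ.* Y ℚ.- Y) ℚ.+ h ℚ.* (P ℚ.* P ℚ.- P)
        ℚ.+ (h ℚ.* (P ℚ.* X) ℚ.+ h ℚ.* (P ℚ.* X)) ℚ.+ (h ℚ.* (P ℚ.* Y) ℚ.+ h ℚ.* (P ℚ.* Y))
      expand = solve 4 (λ h X Y P → h :* ((X :+ Y :+ P) :* (X :+ Y :+ P) :- (X :+ Y :+ P) :- (X :* Y :+ Y :* X)) :=
        h :* (X :* X :- X) :+ h :* (Y :* Y :- Y) :+ h :* (P :* P :- P)
        :+ (h :* (P :* X) :+ h :* (P :* X)) :+ (h :* (P :* Y) :+ h :* (P :* Y))) refl

    -- The degree sum is Z(Z - 1) + Z̄Z = Z(Z + Z̄ - 1). Half of it is the number of all edges, from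
    -- which a and b are taken away; `Z-value` gives it the shape of |E|.
    E-value : ∀ Z Z̄ a b c → Z ℚ.+ P ≡ P ℚ.* Q ℚ.+ P ℚ.* P →
      t ℚ.* a ℚ.+ b ℚ.+ Z ≡ Z ℚ.* Z → b ℚ.+ t ℚ.* c ≡ Z̄ ℚ.* Z → c ≡ E (Z ℚ.+ Z̄) ℚ.- a ℚ.- b
    E-value Z Z̄ a b c Z-eq a-eq c-eq = begin
      c
        ≡⟨ halve c (Z̄ ℚ.* Z ℚ.- b) (isolate (t ℚ.* c) b (Z̄ ℚ.* Z) (trans (ℚ.+-comm (t ℚ.* c) b) c-eq)) ⟩
      h ℚ.* (Z̄ ℚ.* Z ℚ.- b)
        ≡⟨ regroup h Z Z̄ b ⟩
      h ℚ.* (Z ℚ.* (Z ℚ.+ Z̄) ℚ.- Z) ℚ.- h ℚ.* (Z ℚ.* Z ℚ.- Z ℚ.- b) ℚ.- (h ℚ.* b ℚ.+ h ℚ.* b)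
        ≡⟨ cong₂ ℚ._-_ (cong₂ ℚ._-_ total (sym (halve a (Z ℚ.* Z ℚ.- Z ℚ.- b)
             (isolate (t ℚ.* a) b (Z ℚ.* Z ℚ.- Z) (isolate (t ℚ.* a ℚ.+ b) Z (Z ℚ.* Z) a-eq))))) (h-half b) ⟩
      E (Z ℚ.+ Z̄) ℚ.- a ℚ.- b ∎
      where
      open ≡-Reasoning
      total : h ℚ.* (Z ℚ.* (Z ℚ.+ Z̄) ℚ.- Z) ≡ E (Z ℚ.+ Z̄)
      total = cong (h ℚ.*_) (trans (sym (*-pred Z (Z ℚ.+ Z̄))) (cong (ℚ._* (Z ℚ.+ Z̄ ℚ.- o)) (Z-value Z Z-eq)))
      regroup : ∀ h Z Z̄ b → h ℚ.* (Z̄ ℚ.* Z ℚ.- b) ≡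
        h ℚ.* (Z ℚ.* (Z ℚ.+ Z̄) ℚ.- Z) ℚ.- h ℚ.* (Z ℚ.* Z ℚ.- Z ℚ.- b) ℚ.- (h ℚ.* b ℚ.+ h ℚ.* b)
      regroup = solve 4 (λ h Z Z̄ b → h :* (Z̄ :* Z :- b) :=
        h :* (Z :* (Z :+ Z̄) :- Z) :- h :* (Z :* Z :- Z :- b) :- (h :* b :+ h :* b)) refl

    closed-form : ∀ {N Φ Z y a b c} s r → Z ≡ N ℚ.- Φ → y ≡ N ℚ.- Φ ℚ.- o → a ≡ α → b ≡ β →
      c ≡ E N ℚ.- α ℚ.- β →
      a ℚ.* (y ℚ.* s) ℚ.+ b ℚ.* r ℚ.+ c ℚ.* (Z ℚ.* s) ≡
      s ℚ.* α ℚ.* (N ℚ.- Φ ℚ.- o) ℚ.+ β ℚ.* r ℚ.+ s ℚ.* (E N ℚ.- α ℚ.- β) ℚ.* (N ℚ.- Φ)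
    closed-form {N} {Φ} s r refl refl refl refl refl =
      reorder (N ℚ.- Φ) (N ℚ.- Φ ℚ.- o) α β (E N ℚ.- α ℚ.- β) s r
      where
      reorder : ∀ Z y a b c s r → a ℚ.* (y ℚ.* s) ℚ.+ b ℚ.* r ℚ.+ c ℚ.* (Z ℚ.* s) ≡
        s ℚ.* a ℚ.* y ℚ.+ b ℚ.* r ℚ.+ s ℚ.* c ℚ.* Z
      reorder = solve 7 (λ Z y a b c s r → a :* (y :* s) :+ b :* r :+ c :* (Z :* s) :=
        s :* a :* y :+ b :* r :+ s :* c :* Z) refl

ι-1-one : ∀ x → x ℚ.* ι 1 ≡ x
ι-1-one x = trans (cong (x ℚ.*_) ι-1) (ℚ.*-identityʳ x)

ι-2-two : ∀ x → ι 2 ℚ.* x ≡ x ℚ.+ x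
ι-2-two x = trans (cong (ℚ._* x) ι-2) (trans (ℚ.*-distribʳ-+ x 1ℚ 1ℚ) (cong₂ ℚ._+_ (ℚ.*-identityˡ x) (ℚ.*-identityˡ x)))

open ClosedForm (ι 1) ½ (ι 2) ι-1-one ℚ-arithmetic.half+half ι-2-two

-- The Sombor index of a graph with two degree classes

module Sombor {n : ℕ} (G : SimpleGraph n) {S : Fin n → Set} (S? : Unary.Decidable S)
  (y z : ℕ) .{{_ : ℕ.NonZero y}} (1+y≡z : ℕ.suc y ≡ z)
  (degree+S : ∀ u → SimpleGraph.degree G u ℕ.+ 𝟙 (S? u) ≡ z) (∑-S : ∑[ u < n ] 𝟙 (S? u) ≡ z) where

  open SimpleGraph G
  open TwoClasses G S? z degree+S ∑-S

  -- The classes of the endpoints determine their degrees, and exactly one of the three coefficients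
  -- is 1. `F` will be one term of `hypot`; its symmetry merges the two orientations of a mixed
  -- edge. With the decisions as arguments, a match on them also evaluates the indicators in the
  -- degree equations.
  by-classes : ∀ (F : ℕ → ℕ → ℚ) → (∀ d e → F d e ≡ F e d) →
    ∀ {S T : Set} (s : Dec S) (t : Dec T) d e → d ℕ.+ 𝟙 s ≡ z → e ℕ.+ 𝟙 t ≡ z →
    F d e ≡ combine (F y y) (F y z) (F z z)
      (ι (𝟙 s ℕ.* 𝟙 t)) (ι (𝟙 s ℕ.* 𝟙 (¬? t) ℕ.+ 𝟙 (¬? s) ℕ.* 𝟙 t)) (ι (𝟙 (¬? s) ℕ.* 𝟙 (¬? t)))
  by-classes F F-comm = go
    where
    a b c : ℚ
    a = F y y
    b = F y z
    c = F z z
    is-y : ∀ {d} → d ℕ.+ 1 ≡ z → d ≡ y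
    is-y {d} eq = ℕ.suc-injective (trans (ℕ.+-comm 1 d) (trans eq (sym 1+y≡z)))
    is-z : ∀ {d} → d ℕ.+ 0 ≡ z → d ≡ z
    is-z {d} eq = trans (sym (ℕ.+-identityʳ d)) eq
    weights : ∀ {i j k f g h} → ι i ≡ f → ι j ≡ g → ι k ≡ h → combine a b c f g h ≡ combine a b c (ι i) (ι j) (ι k)
    weights refl refl refl = refl
    go : ∀ {S T : Set} (s : Dec S) (t : Dec T) d e → d ℕ.+ 𝟙 s ≡ z → e ℕ.+ 𝟙 t ≡ z →
      F d e ≡ combine a b c
        (ι (𝟙 s ℕ.* 𝟙 t)) (ι (𝟙 s ℕ.* 𝟙 (¬? t) ℕ.+ 𝟙 (¬? s) ℕ.* 𝟙 t)) (ι (𝟙 (¬? s) ℕ.* 𝟙 (¬? t)))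
    go (yes _) (yes _) d e d-eq e-eq = trans (cong₂ F (is-y d-eq) (is-y e-eq))
      (trans (sym (proj₁ (combine-1 a b c))) (weights {1} {0} {0} ι-1 ι-0 ι-0))
    go (yes _) (no _)  d e d-eq e-eq = trans (cong₂ F (is-y d-eq) (is-z e-eq))
      (trans (sym (proj₁ (proj₂ (combine-1 a b c)))) (weights {0} {1} {0} ι-0 ι-1 ι-0))
    go (no _)  (yes _) d e d-eq e-eq = trans (trans (cong₂ F (is-z d-eq) (is-y e-eq)) (F-comm z y))
      (trans (sym (proj₁ (proj₂ (combine-1 a b c)))) (weights {0} {1} {0} ι-0 ι-1 ι-0))
    go (no _)  (no _)  d e d-eq e-eq = trans (cong₂ F (is-z d-eq) (is-z e-eq))
      (trans (sym (proj₂ (proj₂ (combine-1 a b c)))) (weights {0} {0} {1} ι-0 ι-0 ι-1))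

  A B C A′ C′ : ℝ
  A  = hypot y y
  B  = hypot y z
  C  = hypot z z
  A′ = fromℕ y * √ (fromℕ 2)
  C′ = fromℕ z * √ (fromℕ 2)

  weighted : ℝ → ℝ → ℝ → ℝ
  weighted a b c = fromℕ #both * a + fromℕ #mixed * b + fromℕ #neither * c

  weighted-seq : ∀ a b c m → seq (weighted a b c) m ≡
    combine (seq a m) (seq b m) (seq c m) (ι #both) (ι #mixed) (ι #neither)
  weighted-seq a b c m = cong₃ (seq-fromℕ #both m) (seq-fromℕ #mixed m) (seq-fromℕ #neither m)
    where
    cong₃ : ∀ {f g h f′ g′ h′} → f ≡ f′ → g ≡ g′ → h ≡ h′ →
      combine (seq a m) (seq b m) (seq c m) f g h ≡ combine (seq a m) (seq b m) (seq c m) f′ g′ h′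
    cong₃ refl refl refl = refl

  SO-by-classes : SO G ≃ weighted A B C
  SO-by-classes = pointwise {SO G} {weighted A B C} λ m → trans
    (SO-classes G both mixed neither m (seq A m) (seq B m) (seq C m) λ u v →
      by-classes (λ d e → seq (hypot d e) m) (λ d e → hypot-comm d e m)
        (S? u) (S? v) (degree u) (degree v) (degree+S u) (degree+S v))
    (sym (weighted-seq A B C m))

  weighted-cong : ∀ {a b c a′ c′} → a ≃ a′ → c ≃ c′ → weighted a b c ≃ weighted a′ b c′
  weighted-cong {a} {b} {c} {a′} {c′} a≃a′ c≃c′ =
    +-cong {fromℕ #both * a + fromℕ #mixed * b} {fromℕ #both * a′ + fromℕ #mixed * b}
      {fromℕ #neither * c} {fromℕ #neither * c′}
      (+-cong {fromℕ #both * a} {fromℕ #both * a′} {fromℕ #mixed * b} {fromℕ #mixed * b}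
        (*-congˡ (fromℕ #both) (ι #both) {a} {a′} (seq-fromℕ #both) a≃a′)
        (pointwise {fromℕ #mixed * b} {fromℕ #mixed * b} λ _ → refl))
      (*-congˡ (fromℕ #neither) (ι #neither) {c} {c′} (seq-fromℕ #neither) c≃c′)

  SO-value : SO G ≃ weighted A′ B C′
  SO-value = ≃-trans {SO G} {weighted A B C} {weighted A′ B C′} SO-by-classes
    (weighted-cong {A} {B} {C} {A′} {C′} (hypot-diagonal y) (hypot-diagonal z {{subst ℕ.NonZero 1+y≡z _}}))

  -- Here f stands for φ(n), and i and j for the numbers of residues divisible by p only and by q
  -- only; they enter through their equations alone.
  module Evaluate (p q f i j : ℕ) (z+p : z ℕ.+ p ≡ p ℕ.* q ℕ.+ p ℕ.* p) (f+z≡n : f ℕ.+ z ≡ n)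
    (i+p : i ℕ.+ p ≡ p ℕ.* q) (j+p : j ℕ.+ p ≡ p ℕ.* p) (ordered-ij : ordered w w̄ ≡ i ℕ.* j ℕ.+ j ℕ.* i) where

    P Q Z Z̄ : ℚ
    P = ι p
    Q = ι q
    Z = ι z
    Z̄ = ι z̄

    private
      ι-eq-+ : ∀ a b {c} → a ℕ.+ b ≡ c → ι a ℚ.+ ι b ≡ ι c
      ι-eq-+ a b eq = trans (sym (ι-+ a b)) (cong ι eq)

      ι-sum-of-products : ∀ a b c d → ι (a ℕ.* b ℕ.+ c ℕ.* d) ≡ ι a ℚ.* ι b ℚ.+ ι c ℚ.* ι d
      ι-sum-of-products a b c d = trans (ι-+ (a ℕ.* b) (c ℕ.* d)) (cong₂ ℚ._+_ (ι-* a b) (ι-* c d))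

    Z+P : Z ℚ.+ P ≡ P ℚ.* Q ℚ.+ P ℚ.* P
    Z+P = trans (ι-eq-+ z p z+p) (ι-sum-of-products p q p p)

    Z+Z̄ : Z ℚ.+ Z̄ ≡ ι n
    Z+Z̄ = ι-eq-+ z z̄ z+z̄≡n

    Z≡N-Φ : Z ≡ ι n ℚ.- ι f
    Z≡N-Φ = isolate Z (ι f) (ι n) (ι-eq-+ z f (trans (ℕ.+-comm z f) f+z≡n))

    Y≡N-Φ-1 : ι y ≡ ι n ℚ.- ι f ℚ.- ι 1
    Y≡N-Φ-1 = trans (isolate (ι y) (ι 1) Z (ι-eq-+ y 1 (trans (ℕ.+-comm y 1) 1+y≡z))) (cong (ℚ._- ι 1) Z≡N-Φ)

    mixed-XY : ι #mixed ≡ ι i ℚ.* ι j ℚ.+ ι j ℚ.* ι i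
    mixed-XY = trans (cong ι (trans #mixed-ordered ordered-ij)) (ι-sum-of-products i j j i)

    P-part : ι i ℚ.+ P ≡ P ℚ.* Q
    P-part = trans (ι-eq-+ i p i+p) (ι-* p q)

    Q-part : ι j ℚ.+ P ≡ P ℚ.* P
    Q-part = trans (ι-eq-+ j p j+p) (ι-* p p)

    both-eq : ι 2 ℚ.* ι #both ℚ.+ ι #mixed ℚ.+ Z ≡ Z ℚ.* Z
    both-eq = trans (cong (λ t → t ℚ.+ ι #mixed ℚ.+ Z) (sym (ι-* 2 #both)))
      (trans (cong (ℚ._+ Z) (sym (ι-+ (2 ℕ.* #both) #mixed)))
        (trans (ι-eq-+ (2 ℕ.* #both ℕ.+ #mixed) z #both-equation) (ι-* z z)))

    neither-eq : ι #mixed ℚ.+ ι 2 ℚ.* ι #neither ≡ Z̄ ℚ.* Z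
    neither-eq = trans (cong (ι #mixed ℚ.+_) (sym (ι-* 2 #neither)))
      (trans (ι-eq-+ #mixed (2 ℕ.* #neither) #neither-equation) (ι-* z̄ z))

    mixed≡β : ι #mixed ≡ β P Q
    mixed≡β = trans mixed-XY (β-value P Q (ι i) (ι j) P-part Q-part)

    both≡α : ι #both ≡ α P Q
    both≡α = α-value P Q Z (ι #both) (ι #mixed) Z+P
      (trans mixed-XY (cong₂ (λ x y → x ℚ.* y ℚ.+ y ℚ.* x) (X-value P Q (ι i) P-part) (Y-value P Q (ι j) Q-part)))
      both-eq

    neither≡E-α-β : ι #neither ≡ E P Q (ι n) ℚ.- α P Q ℚ.- β P Q
    neither≡E-α-β = trans (E-value P Q Z Z̄ (ι #both) (ι #mixed) (ι #neither) Z+P both-eq neither-eq)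
      (trans (cong (λ N → E P Q N ℚ.- ι #both ℚ.- ι #mixed) Z+Z̄)
        (cong₂ (λ a b → E P Q (ι n) ℚ.- a ℚ.- b) both≡α mixed≡β))

    B-root : ∀ m → seq B m ≡
      root ((ι n ℚ.- ι f ℚ.- ι 1) ℚ.* (ι n ℚ.- ι f ℚ.- ι 1) ℚ.+ (ι n ℚ.- ι f) ℚ.* (ι n ℚ.- ι f)) m
    B-root m = trans (seq-hypot y z m) (cong (λ t → root t m)
      (trans (ι-+ (y ^ 2) (z ^ 2)) (cong₂ ℚ._+_ (trans (ι-^2 y) (cong sq Y≡N-Φ-1)) (trans (ι-^2 z) (cong sq Z≡N-Φ)))))

    -- The variables are to be the m-th terms of the `fromℕ` constants in the theorem, which
    -- `seq-fromℕ` identifies with values of `ι`. Matching on these equations moves the whole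
    -- formula to `ι` at once.
    closed-term : ∀ m {P Q N Φ o t a b c y′ z′} → P ≡ ι p → Q ≡ ι q → N ≡ ι n → Φ ≡ ι f → o ≡ ι 1 → t ≡ ι 2 →
      a ≡ ι #both → b ≡ ι #mixed → c ≡ ι #neither → y′ ≡ ι y → z′ ≡ ι z →
      a ℚ.* (y′ ℚ.* root t m) ℚ.+ b ℚ.* seq B m ℚ.+ c ℚ.* (z′ ℚ.* root t m) ≡
      (let
        α = ½ ℚ.* (P ℚ.* (Q ℚ.- o) ℚ.* (P ℚ.* (Q ℚ.- o) ℚ.- o))
          ℚ.+ ½ ℚ.* (P ℚ.* (P ℚ.- o) ℚ.* (P ℚ.* (P ℚ.- o) ℚ.- o))
          ℚ.+ ½ ℚ.* (P ℚ.* (P ℚ.- o))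
          ℚ.+ P ℚ.* P ℚ.* (Q ℚ.- o)
          ℚ.+ P ℚ.* P ℚ.* (P ℚ.- o)
        β = t ℚ.* (P ℚ.* P) ℚ.* (P ℚ.- o) ℚ.* (Q ℚ.- o)
        E = ½ ℚ.* (P ℚ.* (P ℚ.+ Q ℚ.- o) ℚ.* (N ℚ.- o))
      in root t m ℚ.* α ℚ.* (N ℚ.- Φ ℚ.- o)
        ℚ.+ β ℚ.* root ((N ℚ.- Φ ℚ.- o) ℚ.* (N ℚ.- Φ ℚ.- o) ℚ.+ (N ℚ.- Φ) ℚ.* (N ℚ.- Φ)) m
        ℚ.+ root t m ℚ.* (E ℚ.- α ℚ.- β) ℚ.* (N ℚ.- Φ))
    closed-term m refl refl refl refl refl refl refl refl refl refl refl = trans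
      (closed-form P Q {ι n} {ι f} {Z} {ι y} {ι #both} {ι #mixed} {ι #neither}
        (root (ι 2) m) (seq B m) Z≡N-Φ Y≡N-Φ-1 both≡α mixed≡β neither≡E-α-β)
      (cong (λ r → root (ι 2) m ℚ.* α P Q ℚ.* (ι n ℚ.- ι f ℚ.- ι 1) ℚ.+ β P Q ℚ.* r
        ℚ.+ root (ι 2) m ℚ.* (E P Q (ι n) ℚ.- α P Q ℚ.- β P Q) ℚ.* (ι n ℚ.- ι f)) (B-root m))

    SO-closed-form :
      let
        P = fromℕ p
        Q = fromℕ q
        one = fromℕ 1
        two = fromℕ 2
        half = fromℚ ½
        N = fromℕ n
        Φ = fromℕ f
        α = half * (P * (Q - one) * (P * (Q - one) - one))
          + half * (P * (P - one) * (P * (P - one) - one))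
          + half * (P * (P - one))
          + P * P * (Q - one)
          + P * P * (P - one)
        β = two * (P * P) * (P - one) * (Q - one)
        E = half * (P * (P + Q - one) * (N - one))
      in
      SO G ≃
          √ two * α * (N - Φ - one)
        + β * √ ((N - Φ - one) * (N - Φ - one) + (N - Φ) * (N - Φ))
        + √ two * (E - α - β) * (N - Φ)
    SO-closed-form = ≃-trans {SO G} {weighted A′ B C′} SO-value (pointwise {weighted A′ B C′} λ m →
      closed-term m (seq-fromℕ p m) (seq-fromℕ q m) (seq-fromℕ n m) (seq-fromℕ f m) (seq-fromℕ 1 m) (seq-fromℕ 2 m)
        (seq-fromℕ #both m) (seq-fromℕ #mixed m) (seq-fromℕ #neither m) (seq-fromℕ y m) (seq-fromℕ z m))

theorem3p3 : (p q : ℕ) (p-prime : Prime p) (q-prime : Prime q) →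
    ¬ (2 ∣ p) → ¬ (2 ∣ q) → p < q →
    let
      n = p ^ 2 · q
      G = TΓ ((ℤ/ n) {{p²q-nonZero p-prime q-prime}})
      P = fromℕ p
      Q = fromℕ q
      one = fromℕ 1
      two = fromℕ 2
      half = fromℚ ½
      N = fromℕ n
      Φ = fromℕ (φ n)
      α = half * (P * (Q - one) * (P * (Q - one) - one))
        + half * (P * (P - one) * (P * (P - one) - one))
        + half * (P * (P - one))
        + P * P * (Q - one)
        + P * P * (P - one)
      β = two * (P * P) * (P - one) * (Q - one)
      E = half * (P * (P + Q - one) * (N - one))
    in
    SO G ≃
        √ two * α * (N - Φ - one)
      + β * √ ((N - Φ - one) * (N - Φ - one) + (N - Φ) * (N - Φ))
      + √ two * (E - α - β) * (N - Φ)
theorem3p3 p q p-prime q-prime 2∤p 2∤q p<q =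
  Sombor.Evaluate.SO-closed-form {p ^ 2 · q} (TΓ ((ℤ/ (p ^ 2 · q)) {{p²q-nonZero p-prime q-prime}}))
    -- The smaller degree is `ℕ.pred z`, and `refl` holds because z is defined as the sum of the
    -- indicators of S.
    (λ u → shares? (toℕ u)) (ℕ.pred z) z {{ℕ.>-nonZero (ℕ.≤-pred 2≤1+y)}} 1+y≡z degree+w refl
    p q (φ (p ^ 2 · q)) #P #Q z-value φ+z≡n onlyP-count onlyQ-count ordered-w-w̄
  where
  open TotalGraph p-prime q-prime (ℕ.<⇒≢ p<q) 2∤p 2∤q
  1+y≡z : ℕ.suc (ℕ.pred z) ≡ z
  1+y≡z = ℕ.suc-pred z {{ℕ.>-nonZero (ℕ.<⇒≤ 2≤z)}}
  2≤1+y : 2 ℕ.≤ ℕ.suc (ℕ.pred z)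
  2≤1+y = subst (2 ℕ.≤_) (sym 1+y≡z) 2≤z
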